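{- Let $L_n$ and $C_n$ be the numbers of pure luck guesses and of certified correct guesses in the card guessing game with complete feedback after a single shelf shuffle of $n$ cards. The trivariate generating function $S(z,v,w)=\sum_{n\ge1}\mathbb E(v^{L_n}w^{C_n})z^n$ is given by $$S(z,v,w)=\frac{zw+\dfrac{\frac{z^2w}{2}}{1-\frac{zw}{2}}}{1-\frac{zv}{2}-\dfrac{\frac z2}{1-\frac{zw}{2}}+\frac z2}=\frac{2zw\bigl(2+(1-w)z\bigr)}{4+w(v-1)z^2-2z(v+w)}.$$
   Context: Single shelf shuffle: an ordered deck of $n$ cards labelled $1,\dots,n$ (card $1$ on top, card $n$ at the bottom) is given. Cards are drawn one by one from the bottom of the deck (so in the order $n,n-1,\dots,1$) and put on an initially empty pile; each drawn card is placed, independently, at the top or at the bottom of the pile with probability $1/2$ each. The final pile is the shuffled deck. Game: cards are drawn one after the other from the top of the shuffled deck. Before each draw the player guesses the label of the card; afterwards the card is shown (complete feedback). The player uses the following optimal strategy: the first guess is card $1$; as long as neither card $n-1$ nor card $n$ has been shown, the next guess is the label immediately following that of the most recently shown card; once one of the cards $n-1$ or $n$ has been shown, the player guesses the remaining (not yet shown) cards in descending order. A correct guess is certified if, conditionally on the cards shown before it, it is correct with probability one; it is a pure luck guess if, conditionally on the cards shown before it, it was correct with probability one-half. Every correct guess is of exactly one of these types; $L_n$ counts the pure luck guesses and $C_n$ the certified correct guesses, so $L_n+C_n$ is the total number of correct guesses (in particular $L_1=0$, $C_1=1$). The identity is understood as an identity of formal power series in $z$ with coefficients polynomials in $v,w$.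 -}

module Defs where

open import Algebra.Bundles using (RawRing)
import Algebra.Definitions as AlgebraDefinitions
import Algebra.Definitions.RawSemiring as RawSemiringDefinitions
open import Data.Integer.Base using (+_)
open import Data.List.Base
  using (List; []; _∷_; _++_; _∷ʳ_; map; filter; foldr; length; take; drop; head; last; upTo)
import Data.List.Membership.DecPropositional as DecMembership
import Data.List.Properties as List
open import Data.Maybe.Base as Maybe using (Maybe; just; nothing; From-just; from-just)
import Data.Maybe.Properties as Maybe
open import Data.Nat.Base using (ℕ; zero; suc; _∸_)
import Data.Nat.Properties as ℕ
open import Data.Product.Base using (_×_; _,_)
open import Data.Rational.Base using (ℚ; 0ℚ; 1ℚ; ½; _/_; +-*-rawRing)
import Data.Rational.Properties as ℚ
open import Data.Vec.Base as Vec using (Vec; []; _∷_)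
open import Level using (0ℓ)
open import Relation.Binary.Consequences using (dec⇒weaklyDec)
open import Relation.Binary.Definitions using (WeaklyDecidable)
open import Relation.Binary.PropositionalEquality.Core using (_≡_)
open import Relation.Nullary.Decidable using (yes; no; _⊎-dec_; _×-dec_)
open import Relation.Unary using (Pred; Decidable)
open import Relation.Unary.Properties using (_∩?_)

module _ {c ℓ} (R : RawRing c ℓ) where
  open RawRing R renaming (Carrier to A)

  coeff : List A → ℕ → A
  coeff []      _       = 0#
  coeff (a ∷ p) zero    = a
  coeff (a ∷ p) (suc k) = coeff p k

  addPoly : List A → List A → List A
  addPoly []      q       = q
  addPoly (a ∷ p) []      = a ∷ p
  addPoly (a ∷ p) (b ∷ q) = a + b ∷ addPoly p q

  mulPoly : List A → List A → List A
  mulPoly []      q = []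
  mulPoly (a ∷ p) q = addPoly (map (a *_) q) (0# ∷ mulPoly p q)

  -- Coefficient lists, constant term first.  Trailing zeros are allowed, so
  -- equality is coefficientwise.
  polynomials : RawRing c ℓ
  polynomials = record
    { Carrier = List A
    ; _≈_     = λ p q → ∀ k → coeff p k ≈ coeff q k
    ; _+_     = addPoly
    ; _*_     = mulPoly
    ; -_      = map -_
    ; 0#      = []
    ; 1#      = 1# ∷ []
    }

  equal? : WeaklyDecidable _≈_ → WeaklyDecidable (RawRing._≈_ polynomials)
  equal? _≟_ []      []      = Maybe.map (λ eq _ → eq) (0# ≟ 0#)
  equal? _≟_ []      (b ∷ q) = Maybe.zipWith (λ eq eqs → λ { zero → eq ; (suc k) → eqs k })
                                 (0# ≟ b) (equal? _≟_ [] q)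
  equal? _≟_ (a ∷ p) []      = Maybe.zipWith (λ eq eqs → λ { zero → eq ; (suc k) → eqs k })
                                 (a ≟ 0#) (equal? _≟_ p [])
  equal? _≟_ (a ∷ p) (b ∷ q) = Maybe.zipWith (λ eq eqs → λ { zero → eq ; (suc k) → eqs k })
                                 (a ≟ b) (equal? _≟_ p q)

  -- cauchy f g n = f 0 * g n + f 1 * g (n - 1) + … + f n * g 0
  cauchy : (ℕ → A) → (ℕ → A) → ℕ → A
  cauchy f g zero    = f 0 * g 0
  cauchy f g (suc n) = f 0 * g (suc n) + cauchy (λ k → f (suc k)) g n

  constSeries : A → ℕ → A
  constSeries a zero    = a
  constSeries a (suc _) = 0#

  series : RawRing c ℓ
  series = record
    { Carrier = ℕ → A
    ; _≈_     = λ f g → ∀ n → f n ≈ g n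
    ; _+_     = λ f g n → f n + g n
    ; _*_     = cauchy
    ; -_      = λ f n → - f n
    ; 0#      = λ _ → 0#
    ; 1#      = constSeries 1#
    }

  UnitConstant : (ℕ → A) → Set _
  UnitConstant g = AlgebraDefinitions.LeftInvertible _≈_ 1# _*_ (g 0)

  dot : ∀ {n} → (ℕ → A) → Vec A n → A
  dot g []       = 0#
  dot g (h ∷ hs) = g 0 * h + dot (λ k → g (suc k)) hs

  -- The coefficients h n, …, h 1, h 0 of the inverse h of g, where u is the
  -- inverse of g 0:  h (n + 1) = - u * (g 1 * h n + … + g (n + 1) * h 0).
  inverseUpTo : (g : ℕ → A) → UnitConstant g → (n : ℕ) → Vec A (suc n)
  inverseUpTo g (u , _)      zero    = u ∷ []
  inverseUpTo g unit@(u , _) (suc n) =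
    let hs = inverseUpTo g unit n in
    - (u * dot (λ k → g (suc k)) hs) ∷ hs

  inverse : (g : ℕ → A) → UnitConstant g → ℕ → A
  inverse g unit n = Vec.head (inverseUpTo g unit n)

-- Polynomials in w with coefficients in ℚ[v].
ℚ[v,w] : RawRing 0ℓ 0ℓ
ℚ[v,w] = polynomials (polynomials +-*-rawRing)

module ℚ[v,w] where
  open RawRing ℚ[v,w] public
  open RawSemiringDefinitions rawSemiring public using (_^_)

  const : ℚ → Carrier
  const q = (q ∷ []) ∷ []

  v w : Carrier
  v = (0ℚ ∷ 1ℚ ∷ []) ∷ []
  w = [] ∷ (1ℚ ∷ []) ∷ []

data Side : Set where
  top bottom : Side

place : Side → ℕ → List ℕ → List ℕ
place top    c p = c ∷ p
place bottom c p = p ∷ʳ c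

-- The pile (top card first) after drawing the cards i + n - 1, …, i + 1, i in
-- this order; the sides are listed in the order of the card labels.
pileFrom : ∀ {n} → ℕ → Vec Side n → List ℕ
pileFrom i []       = []
pileFrom i (s ∷ ss) = place s i (pileFrom (suc i) ss)

shuffle : ∀ {n} → Vec Side n → List ℕ
shuffle = pileFrom 1

Ω : ℕ → Set
Ω = Vec Side

outcomes : ∀ n → List (Ω n)
outcomes zero    = [] ∷ []
outcomes (suc n) = map (top ∷_) (outcomes n) ++ map (bottom ∷_) (outcomes n)

count : ∀ {n} {A : Pred (Ω n) 0ℓ} → Decidable A → ℕ
count {n} A? = length (filter A? (outcomes n))

-- The outcomes are equiprobable, so this is a ratio of counts; by convention
-- it is 0 if the condition is impossible.
ℙ[_∣_] : ∀ {n} {A B : Pred (Ω n) 0ℓ} → Decidable A → Decidable B → ℚ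
ℙ[ A? ∣ B? ] with count B?
... | zero  = 0ℚ
... | suc m = + count (A? ∩? B?) / suc m

𝔼 : ∀ {n} → (Ω n → ℚ[v,w].Carrier) → ℚ[v,w].Carrier
𝔼 {n} X = foldr (λ ω e → const ½ ^ n * X ω + e) 0# (outcomes n)
  where open ℚ[v,w]

open DecMembership ℕ._≟_ using (_∈_; _∈?_)

-- The largest of the labels 1, …, m not in the list (0 if there is none).
largestUnshown : ℕ → List ℕ → ℕ
largestUnshown zero    cs = 0
largestUnshown (suc m) cs with suc m ∈? cs
... | yes _ = largestUnshown m cs
... | no  _ = suc m

-- The guess when the cards cs have been shown, the most recent one last.  For
-- n ≡ 1 the number n ∸ 1 ≡ 0 is not a label and hence never shown.
guess : ℕ → List ℕ → ℕ
guess n cs with (n ∸ 1 ∈? cs) ⊎-dec (n ∈? cs) | last cs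
... | yes _ | _       = largestUnshown n cs
... | no  _ | nothing = 1
... | no  _ | just c  = suc c

module _ {n : ℕ} where

  -- In the following, k cards of the shuffled deck have already been shown.

  shown : ℕ → Ω n → List ℕ
  shown k ω = take k (shuffle ω)

  next : ℕ → Ω n → Maybe ℕ
  next k ω = head (drop k (shuffle ω))

  Correct : ℕ → Pred (Ω n) 0ℓ
  Correct k ω = next k ω ≡ just (guess n (shown k ω))

  correct? : ∀ k → Decidable (Correct k)
  correct? k ω = Maybe.≡-dec ℕ._≟_ (next k ω) (just (guess n (shown k ω)))

  SameShown : ℕ → Ω n → Pred (Ω n) 0ℓ
  SameShown k ω ω′ = shown k ω′ ≡ shown k ω

  sameShown? : ∀ k ω → Decidable (SameShown k ω)
  sameShown? k ω ω′ = List.≡-dec ℕ._≟_ (shown k ω′) (shown k ω)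

  successProbability : ℕ → Ω n → ℚ
  successProbability k ω = ℙ[ correct? k ∣ sameShown? k ω ]

  Certified PureLuck : Ω n → Pred ℕ 0ℓ
  Certified ω k = Correct k ω × successProbability k ω ≡ 1ℚ
  PureLuck  ω k = Correct k ω × successProbability k ω ≡ ½

  certified? : ∀ ω → Decidable (Certified ω)
  certified? ω k = correct? k ω ×-dec (successProbability k ω ℚ.≟ 1ℚ)

  pureLuck? : ∀ ω → Decidable (PureLuck ω)
  pureLuck? ω k = correct? k ω ×-dec (successProbability k ω ℚ.≟ ½)

  L C : Ω n → ℕ
  L ω = length (filter (pureLuck? ω) (upTo n))
  C ω = length (filter (certified? ω) (upTo n))

ℚ[v,w]⟦z⟧ : RawRing 0ℓ 0ℓ
ℚ[v,w]⟦z⟧ = series ℚ[v,w]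

open RawRing ℚ[v,w]⟦z⟧ public using (_≈_; _+_; _*_; -_; 0#; 1#)
  renaming (Carrier to Series)
open RawSemiringDefinitions (RawRing.rawSemiring ℚ[v,w]⟦z⟧) public using (_^_)

infixl 6 _-_
_-_ : Series → Series → Series
f - g = f + (- g)

infixl 7 _÷_[_]
_÷_[_] : Series → (g : Series) → UnitConstant ℚ[v,w] g → Series
f ÷ g [ unit ] = f * inverse ℚ[v,w] g unit

⌜_⌝ : ℚ → Series
⌜ q ⌝ = constSeries ℚ[v,w] (ℚ[v,w].const q)

½ₛ 2ₛ 4ₛ : Series
½ₛ = ⌜ ½ ⌝
2ₛ = ⌜ + 2 / 1 ⌝
4ₛ = ⌜ + 4 / 1 ⌝

z v w : Series
z 1 = ℚ[v,w].1#
z _ = ℚ[v,w].0#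
v   = constSeries ℚ[v,w] ℚ[v,w].v
w   = constSeries ℚ[v,w] ℚ[v,w].w

S : Series
S zero      = ℚ[v,w].0#
S n@(suc _) = 𝔼 {n} (λ ω → ℚ[v,w].v ℚ[v,w].^ L ω ℚ[v,w].* ℚ[v,w].w ℚ[v,w].^ C ω)

private
  Unit : Series → Set
  Unit = UnitConstant ℚ[v,w]

  infix 4 _≟ₚ_
  _≟ₚ_ : WeaklyDecidable (RawRing._≈_ ℚ[v,w])
  _≟ₚ_ = equal? _ (equal? _ (dec⇒weaklyDec ℚ._≟_))

  inverseOf : (u : ℚ[v,w].Carrier) (g : Series) → From-just (u ℚ[v,w].* g 0 ≟ₚ ℚ[v,w].1#)
  inverseOf u g = from-just (u ℚ[v,w].* g 0 ≟ₚ ℚ[v,w].1#)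

unit₁ : Unit (1# - ½ₛ * z * w)
unit₁ = ℚ[v,w].1# , inverseOf ℚ[v,w].1# (1# - ½ₛ * z * w)

unit₂ : Unit (1# - ½ₛ * z * v - (½ₛ * z) ÷ (1# - ½ₛ * z * w) [ unit₁ ] + ½ₛ * z)
unit₂ = ℚ[v,w].1# , inverseOf ℚ[v,w].1#
  (1# - ½ₛ * z * v - (½ₛ * z) ÷ (1# - ½ₛ * z * w) [ unit₁ ] + ½ₛ * z)

unit₃ : Unit (4ₛ + w * (v - 1#) * z ^ 2 - 2ₛ * z * (v + w))
unit₃ = ℚ[v,w].const (+ 1 / 4) , inverseOf (ℚ[v,w].const (+ 1 / 4))
  (4ₛ + w * (v - 1#) * z ^ 2 - 2ₛ * z * (v + w))

{-# OPTIONS --safe #-}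
module Submission where

-- The pile consists of the cards placed on top in ascending order followed by the others in
-- descending order.  Until n - 1 or n is shown, flipping the side of the guessed card keeps
-- the shown cards and toggles the correctness of the guess, which is therefore pure luck;
-- afterwards the remaining cards are in descending order and every guess is certified.
-- Hence a pure luck guess succeeds precisely at a card i < n on top whose predecessor is
-- on top too (card 0 counting as such), and there are as many certified guesses as cards
-- below n placed at the bottom, plus one if n - 1 is on top.  With A and B the generating functions of the
-- runs whose preceding card is on top or at the bottom, this is the two-state recurrence
--   A = w + z/2 (v A + w B),   B = 1 + z/2 (A + w B),   S = z A,
-- and eliminating B gives the two fractions.

open import Algebra.Bundles using (RawRing; CommutativeRing)
import Algebra.Definitions.RawSemiring as RawSemiringDefinitions
import Algebra.Morphism.Construct.Composition as Composition
import Algebra.Morphism.RingMonomorphism as RingMonomorphism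
open import Algebra.Morphism.Structures using (IsRingHomomorphism; IsRingMonomorphism)
import Algebra.Properties.CommutativeSemigroup as CommutativeSemigroupProperties
import Algebra.Properties.Ring as RingProperties
import Algebra.Solver.Ring as RingSolver
open import Algebra.Solver.Ring.AlmostCommutativeRing
  using (fromCommutativeRing; _-Raw-AlmostCommutative⟶_; Induced-equivalence)
import Data.Integer.Base as ℤ
open import Data.List.Base using (List; []; _∷_; _++_; map; foldr)
open import Data.Maybe.Base as Maybe using ()
open import Data.Nat.Base using (ℕ; zero; suc)
open import Data.Product.Base using (_×_; _,_; proj₁; proj₂)
open import Data.Rational.Base using (ℚ; 1ℚ; ½; _/_; +-*-rawRing)
import Data.Rational.Properties as ℚ
open import Data.Vec.Base using ([]; _∷_)
open import Function.Base using (_∘_)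
open import Relation.Binary.Consequences using (dec⇒weaklyDec)
open import Relation.Binary.Definitions using (WeaklyDecidable)
import Relation.Binary.PropositionalEquality as ≡
import Relation.Binary.Reasoning.Setoid as SetoidReasoning
open import Defs using
  ( coeff; addPoly; mulPoly; polynomials; cauchy; constSeries; series
  ; UnitConstant; dot; inverseUpTo; inverse; ℚ[v,w]; module ℚ[v,w]; ℚ[v,w]⟦z⟧; ⌜_⌝
  ; Side; top; bottom; Ω; outcomes)

-- Formal power series over a commutative ring.

module PowerSeries {c ℓ} (R : CommutativeRing c ℓ) where
  open CommutativeRing R renaming (Carrier to A)
  open RingProperties ring using (-‿distribʳ-*; -0#≈0#)
  open CommutativeSemigroupProperties +-commutativeSemigroup using (interchange)
  open SetoidReasoning setoid

  private
    infixl 7 _⊛_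
    _⊛_ : (ℕ → A) → (ℕ → A) → ℕ → A
    _⊛_ = cauchy rawRing

    variable
      f f′ g g′ h : ℕ → A

  ⊛-cong : (∀ k → f k ≈ f′ k) → (∀ k → g k ≈ g′ k) → ∀ n → (f ⊛ g) n ≈ (f′ ⊛ g′) n
  ⊛-cong f≈ g≈ zero    = *-cong (f≈ 0) (g≈ 0)
  ⊛-cong f≈ g≈ (suc n) = +-cong (*-cong (f≈ 0) (g≈ (suc n))) (⊛-cong (f≈ ∘ suc) g≈ n)

  ⊛-zeroˡ : ∀ g n → ((λ _ → 0#) ⊛ g) n ≈ 0#
  ⊛-zeroˡ g zero    = zeroˡ (g 0)
  ⊛-zeroˡ g (suc n) = trans (+-cong (zeroˡ (g (suc n))) (⊛-zeroˡ g n)) (+-identityˡ 0#)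

  ⊛-constˡ : ∀ a g n → (constSeries rawRing a ⊛ g) n ≈ a * g n
  ⊛-constˡ a g zero    = refl
  ⊛-constˡ a g (suc n) = trans (+-congˡ (⊛-zeroˡ g n)) (+-identityʳ (a * g (suc n)))

  ⊛-distribʳ : ∀ h f g n → ((λ k → f k + g k) ⊛ h) n ≈ (f ⊛ h) n + (g ⊛ h) n
  ⊛-distribʳ h f g zero    = distribʳ (h 0) (f 0) (g 0)
  ⊛-distribʳ h f g (suc n) = trans
    (+-cong (distribʳ (h (suc n)) (f 0) (g 0)) (⊛-distribʳ h (f ∘ suc) (g ∘ suc) n))
    (interchange (f 0 * h (suc n)) (g 0 * h (suc n)) ((f ∘ suc ⊛ h) n) ((g ∘ suc ⊛ h) n))

  ⊛-scaleˡ : ∀ a f g n → ((λ k → a * f k) ⊛ g) n ≈ a * (f ⊛ g) n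
  ⊛-scaleˡ a f g zero    = *-assoc a (f 0) (g 0)
  ⊛-scaleˡ a f g (suc n) = trans
    (+-cong (*-assoc a (f 0) (g (suc n))) (⊛-scaleˡ a (f ∘ suc) g n))
    (sym (distribˡ a (f 0 * g (suc n)) ((f ∘ suc ⊛ g) n)))

  -- The recursion of `cauchy` peels off the term with `f 0`. Peeling off the term with `g 0`
  -- instead is what lets commutativity go by induction.
  ⊛-splitLast : ∀ f g n → (f ⊛ g) (suc n) ≈ (f ⊛ g ∘ suc) n + f (suc n) * g 0
  ⊛-splitLast f g zero    = refl
  ⊛-splitLast f g (suc n) = trans
    (+-congˡ (⊛-splitLast (f ∘ suc) g n))
    (sym (+-assoc (f 0 * g (suc (suc n))) ((f ∘ suc ⊛ g ∘ suc) n) (f (suc (suc n)) * g 0)))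

  ⊛-comm : ∀ f g n → (f ⊛ g) n ≈ (g ⊛ f) n
  ⊛-comm f g zero    = *-comm (f 0) (g 0)
  ⊛-comm f g (suc n) = begin
    f 0 * g (suc n) + (f ∘ suc ⊛ g) n  ≈⟨ +-cong (*-comm (f 0) (g (suc n))) (⊛-comm (f ∘ suc) g n) ⟩
    g (suc n) * f 0 + (g ⊛ f ∘ suc) n  ≈⟨ +-comm (g (suc n) * f 0) ((g ⊛ f ∘ suc) n) ⟩
    (g ⊛ f ∘ suc) n + g (suc n) * f 0  ≈⟨ ⊛-splitLast g f n ⟨
    (g ⊛ f) (suc n)                    ∎

  ⊛-assoc : ∀ f g h n → ((f ⊛ g) ⊛ h) n ≈ (f ⊛ (g ⊛ h)) n
  ⊛-assoc f g h zero    = *-assoc (f 0) (g 0) (h 0)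
  ⊛-assoc f g h (suc n) = begin
    f 0 * g 0 * h (suc n) + ((λ k → f 0 * g (suc k) + (f ∘ suc ⊛ g) k) ⊛ h) n
      ≈⟨ +-congˡ (⊛-distribʳ h (λ k → f 0 * g (suc k)) (f ∘ suc ⊛ g) n) ⟩
    f 0 * g 0 * h (suc n) + (((λ k → f 0 * g (suc k)) ⊛ h) n + ((f ∘ suc ⊛ g) ⊛ h) n)
      ≈⟨ +-cong (*-assoc (f 0) (g 0) (h (suc n)))
           (+-cong (⊛-scaleˡ (f 0) (g ∘ suc) h n) (⊛-assoc (f ∘ suc) g h n)) ⟩
    f 0 * (g 0 * h (suc n)) + (f 0 * (g ∘ suc ⊛ h) n + (f ∘ suc ⊛ (g ⊛ h)) n)
      ≈⟨ +-assoc _ _ _ ⟨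
    f 0 * (g 0 * h (suc n)) + f 0 * (g ∘ suc ⊛ h) n + (f ∘ suc ⊛ (g ⊛ h)) n
      ≈⟨ +-congʳ (distribˡ (f 0) (g 0 * h (suc n)) ((g ∘ suc ⊛ h) n)) ⟨
    f 0 * (g 0 * h (suc n) + (g ∘ suc ⊛ h) n) + (f ∘ suc ⊛ (g ⊛ h)) n
      ∎

  ⊛-identityˡ : ∀ g n → (constSeries rawRing 1# ⊛ g) n ≈ g n
  ⊛-identityˡ g n = trans (⊛-constˡ 1# g n) (*-identityˡ (g n))

  commutativeRing : CommutativeRing c ℓ
  commutativeRing = record
    { RawRing (series rawRing)
    ; isCommutativeRing = record
      { isRing = record
        { +-isAbelianGroup = record
          { isGroup = record
            { isMonoid = record
              { isSemigroup = record
                { isMagma = record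
                  { isEquivalence = record
                    { refl  = λ _ → refl
                    ; sym   = λ f≈g n → sym (f≈g n)
                    ; trans = λ f≈g g≈h n → trans (f≈g n) (g≈h n)
                    }
                  ; ∙-cong = λ f≈f′ g≈g′ n → +-cong (f≈f′ n) (g≈g′ n)
                  }
                ; assoc = λ f g h n → +-assoc (f n) (g n) (h n)
                }
              ; identity = (λ f n → +-identityˡ (f n)) , (λ f n → +-identityʳ (f n))
              }
            ; inverse = (λ f n → -‿inverseˡ (f n)) , (λ f n → -‿inverseʳ (f n))
            ; ⁻¹-cong = λ f≈g n → -‿cong (f≈g n)
            }
          ; comm = λ f g n → +-comm (f n) (g n)
          }
        ; *-cong = ⊛-cong
        ; *-assoc = ⊛-assoc
        ; *-identity = ⊛-identityˡ
                     , λ f n → trans (⊛-comm f (constSeries rawRing 1#) n) (⊛-identityˡ f n)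
        ; distrib = (λ h f g n → trans (⊛-comm h (λ k → f k + g k) n)
                      (trans (⊛-distribʳ h f g n) (+-cong (⊛-comm f h n) (⊛-comm g h n))))
                  , ⊛-distribʳ
        }
      ; *-comm = ⊛-comm
      }
    }

  constSeries-isRingHomomorphism :
    IsRingHomomorphism rawRing (series rawRing) (constSeries rawRing)
  constSeries-isRingHomomorphism = record
    { isSemiringHomomorphism = record
      { isNearSemiringHomomorphism = record
        { +-isMonoidHomomorphism = record
          { isMagmaHomomorphism = record
            { isRelHomomorphism = record { cong = λ { a≈b zero → a≈b ; a≈b (suc n) → refl } }
            ; homo = λ { a b zero → refl ; a b (suc n) → sym (+-identityˡ 0#) }
            }
          ; ε-homo = λ { zero → refl ; (suc n) → refl }
          }
        ; *-homo = λ
          { a b zero    → refl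
          ; a b (suc n) → sym (trans (⊛-constˡ a (constSeries rawRing b) (suc n)) (zeroʳ a))
          }
        }
      ; 1#-homo = λ _ → refl
      }
    ; -‿homo = λ { a zero → refl ; a (suc n) → sym -0#≈0# }
    }

  module _ (g : ℕ → A) (unit : UnitConstant rawRing g) where
    private
      u = proj₁ unit
      g⁻¹ = inverse rawRing g unit

    -- `inverseUpTo` lists its coefficients from the n-th down to the 0-th, so pairing it with `f`
    -- in ascending order is already a convolution.
    dot-inverseUpTo : ∀ f n → dot rawRing f (inverseUpTo rawRing g unit n) ≈ (f ⊛ g⁻¹) n
    dot-inverseUpTo f zero    = +-identityʳ (f 0 * u)
    dot-inverseUpTo f (suc n) = +-congˡ (dot-inverseUpTo (f ∘ suc) n)

    -- Coefficient n + 1 of the inverse is - (u * d), where d is the contribution of the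
    -- coefficients of `g` after the first. Since g 0 * u ≈ 1#, the two contributions cancel.
    ⊛-inverseʳ : ∀ n → (g ⊛ g⁻¹) n ≈ constSeries rawRing 1# n
    ⊛-inverseʳ zero    = trans (*-comm (g 0) u) (proj₂ unit)
    ⊛-inverseʳ (suc n) = begin
      g 0 * - (u * d) + (g ∘ suc ⊛ g⁻¹) n  ≈⟨ +-congˡ (dot-inverseUpTo (g ∘ suc) n) ⟨
      g 0 * - (u * d) + d                  ≈⟨ +-congʳ (-‿distribʳ-* (g 0) (u * d)) ⟨
      - (g 0 * (u * d)) + d                ≈⟨ +-congʳ (-‿cong (*-assoc (g 0) u d)) ⟨
      - (g 0 * u * d) + d
        ≈⟨ +-congʳ (-‿cong (*-congʳ (trans (*-comm (g 0) u) (proj₂ unit)))) ⟩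
      - (1# * d) + d                       ≈⟨ +-congʳ (-‿cong (*-identityˡ d)) ⟩
      - d + d                              ≈⟨ -‿inverseˡ d ⟩
      0#                                   ∎
      where d = dot rawRing (g ∘ suc) (inverseUpTo rawRing g unit n)

-- Polynomials as a subring of the power series.

module Polynomials {c ℓ} (R : CommutativeRing c ℓ) where
  open CommutativeRing R renaming (Carrier to A)
  open RingProperties ring using (-0#≈0#)

  private
    co : List A → ℕ → A
    co = coeff rawRing

  -- Beyond the end of the list both coefficients are defaults, 0# on the left and φ 0# on the
  -- right; the hypothesis identifies them.
  coeff-map : ∀ {φ} → 0# ≈ φ 0# → ∀ p n → co (map φ p) n ≈ φ (co p n)
  coeff-map 0≈ []      n       = 0≈
  coeff-map 0≈ (a ∷ p) zero    = refl
  coeff-map 0≈ (a ∷ p) (suc n) = coeff-map 0≈ p n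

  coeff-addPoly : ∀ p q n → co (addPoly rawRing p q) n ≈ co p n + co q n
  coeff-addPoly []      q       n       = sym (+-identityˡ (co q n))
  coeff-addPoly (a ∷ p) []      n       = sym (+-identityʳ (co (a ∷ p) n))
  coeff-addPoly (a ∷ p) (b ∷ q) zero    = refl
  coeff-addPoly (a ∷ p) (b ∷ q) (suc n) = coeff-addPoly p q n

  coeff-mulPoly : ∀ p q n → co (mulPoly rawRing p q) n ≈ cauchy rawRing (co p) (co q) n
  coeff-mulPoly []      q n = sym (PowerSeries.⊛-zeroˡ R (co q) n)
  coeff-mulPoly (a ∷ p) q n = trans
    (coeff-addPoly (map (a *_) q) (0# ∷ mulPoly rawRing p q) n)
    (trans (+-congʳ (coeff-map (sym (zeroʳ a)) q n)) (lemma n))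
    where
    lemma : ∀ n → a * co q n + co (0# ∷ mulPoly rawRing p q) n ≈ cauchy rawRing (co (a ∷ p)) (co q) n
    lemma zero    = +-identityʳ (a * co q 0)
    lemma (suc n) = +-congˡ (coeff-mulPoly p q n)

  coeff-constant : ∀ a n → co (a ∷ []) n ≈ constSeries rawRing a n
  coeff-constant a zero    = refl
  coeff-constant a (suc n) = refl

  -- Equality of polynomials is defined as equality of coefficient sequences, so `coeff` is
  -- injective by definition and the ring laws are inherited from the power series.
  coeff-isRingMonomorphism : IsRingMonomorphism (polynomials rawRing) (series rawRing) co
  coeff-isRingMonomorphism = record
    { isRingHomomorphism = record
      { isSemiringHomomorphism = record
        { isNearSemiringHomomorphism = record
          { +-isMonoidHomomorphism = record
            { isMagmaHomomorphism = record
              { isRelHomomorphism = record { cong = λ p≈q → p≈q }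
              ; homo = coeff-addPoly
              }
            ; ε-homo = λ _ → refl
            }
          ; *-homo = coeff-mulPoly
          }
        ; 1#-homo = coeff-constant 1#
        }
      ; -‿homo = coeff-map (sym -0#≈0#)
      }
    ; injective = λ p≈q → p≈q
    }

  commutativeRing : CommutativeRing c ℓ
  commutativeRing = record
    { isCommutativeRing = RingMonomorphism.isCommutativeRing coeff-isRingMonomorphism
        (CommutativeRing.isCommutativeRing (PowerSeries.commutativeRing R))
    }

  constant-isRingHomomorphism : IsRingHomomorphism rawRing (polynomials rawRing) (_∷ [])
  constant-isRingHomomorphism = record
    { isSemiringHomomorphism = record
      { isNearSemiringHomomorphism = record
        { +-isMonoidHomomorphism = record
          { isMagmaHomomorphism = record
            { isRelHomomorphism = record { cong = λ { a≈b zero → a≈b ; a≈b (suc n) → refl } }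
            ; homo = λ _ _ _ → refl
            }
          ; ε-homo = λ { zero → refl ; (suc n) → refl }
          }
        ; *-homo = λ { a b zero → sym (+-identityʳ (a * b)) ; a b (suc n) → refl }
        }
      ; 1#-homo = λ _ → refl
      }
    ; -‿homo = λ _ _ → refl
    }

-- The coefficient rings and their rational constants.

ℚ[v]-commutativeRing ℚ[v,w]-commutativeRing ℚ[v,w]⟦z⟧-commutativeRing : CommutativeRing _ _
ℚ[v]-commutativeRing      = Polynomials.commutativeRing ℚ.+-*-commutativeRing
ℚ[v,w]-commutativeRing    = Polynomials.commutativeRing ℚ[v]-commutativeRing
ℚ[v,w]⟦z⟧-commutativeRing = PowerSeries.commutativeRing ℚ[v,w]-commutativeRing

ℚ[v,w]-const-isRingHomomorphism : IsRingHomomorphism +-*-rawRing ℚ[v,w] ℚ[v,w].const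
ℚ[v,w]-const-isRingHomomorphism = Composition.isRingHomomorphism
  (λ {f} {g} {h} → CommutativeRing.trans ℚ[v,w]-commutativeRing {f} {g} {h})
  (Polynomials.constant-isRingHomomorphism ℚ.+-*-commutativeRing)
  (Polynomials.constant-isRingHomomorphism ℚ[v]-commutativeRing)

⌜⌝-isRingHomomorphism : IsRingHomomorphism +-*-rawRing ℚ[v,w]⟦z⟧ ⌜_⌝
⌜⌝-isRingHomomorphism = Composition.isRingHomomorphism
  (λ {f} {g} {h} → CommutativeRing.trans ℚ[v,w]⟦z⟧-commutativeRing {f} {g} {h})
  ℚ[v,w]-const-isRingHomomorphism
  (PowerSeries.constSeries-isRingHomomorphism ℚ[v,w]-commutativeRing)

-- Elimination in the two-state system and comparison of the two fractions.

module ℚ-Algebra {c ℓ} (K : CommutativeRing c ℓ)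
  (⟦_⟧ : ℚ → CommutativeRing.Carrier K)
  (isHomo : IsRingHomomorphism +-*-rawRing (CommutativeRing.rawRing K) ⟦_⟧) where
  open CommutativeRing K
  private
    ι : +-*-rawRing -Raw-AlmostCommutative⟶ fromCommutativeRing K
    ι = record
      { IsRingHomomorphism isHomo
      ; ⟦_⟧ = ⟦_⟧
      ; 0-homo = IsRingHomomorphism.0#-homo isHomo
      ; 1-homo = IsRingHomomorphism.1#-homo isHomo
      }

    ⟦⟧-weaklyDec : WeaklyDecidable (Induced-equivalence ι)
    ⟦⟧-weaklyDec p q = Maybe.map (λ p≡q → reflexive (≡.cong ⟦_⟧ p≡q)) (dec⇒weaklyDec ℚ._≟_ p q)

  open RingSolver +-*-rawRing (fromCommutativeRing K) ι ⟦⟧-weaklyDec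
    using (solve; con; _:+_; _:*_; _:-_; _:^_; _:=_)
  open SetoidReasoning setoid

  x/y-unique : ∀ {x y y⁻¹ n} → y * y⁻¹ ≈ 1# → x * y ≈ n → x ≈ n * y⁻¹
  x/y-unique {x} {y} {y⁻¹} {n} yy⁻¹≈1 xy≈n = begin
    x              ≈⟨ *-identityʳ x ⟨
    x * 1#         ≈⟨ *-congˡ yy⁻¹≈1 ⟨
    x * (y * y⁻¹)  ≈⟨ *-assoc x y y⁻¹ ⟨
    x * y * y⁻¹    ≈⟨ *-congʳ xy≈n ⟩
    n * y⁻¹        ∎

  n/y*y : ∀ {y y⁻¹} n → y * y⁻¹ ≈ 1# → n * y⁻¹ * y ≈ n
  n/y*y {y} {y⁻¹} n yy⁻¹≈1 = begin
    n * y⁻¹ * y    ≈⟨ *-assoc n y⁻¹ y ⟩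
    n * (y⁻¹ * y)  ≈⟨ *-congˡ (trans (*-comm y⁻¹ y) yy⁻¹≈1) ⟩
    n * 1#         ≈⟨ *-identityʳ n ⟩
    n              ∎

  private
    h 2ᴷ 4ᴷ : Carrier
    h = ⟦ ½ ⟧
    2ᴷ = ⟦ ℤ.+ 2 / 1 ⟧
    4ᴷ = ⟦ ℤ.+ 4 / 1 ⟧

    -- It evaluates to 1# on the nose, whereas con 1ℚ evaluates to ⟦ 1ℚ ⟧.
    1#′ : ∀ {n} → RingSolver.Polynomial +-*-rawRing (fromCommutativeRing K) ι _ n
    1#′ = con 1ℚ :^ 0

  -- i is the inverse of 1 - z w / 2.
  module _ (z v w i : Carrier) where
    -- `z * (z * 1#)` is what `z ^ 2` unfolds to, so in the ring of series these are definitionally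
    -- the numerators and denominators of the theorem.
    numerator₁ denominator₁ numerator₂ denominator₂ : Carrier
    numerator₁   = z * w + (h * (z * (z * 1#)) * w) * i
    denominator₁ = 1# + - (h * z * v) + - ((h * z) * i) + h * z
    numerator₂   = 2ᴷ * z * w * (2ᴷ + (1# + - w) * z)
    denominator₂ = 4ᴷ + w * (v + - 1#) * (z * (z * 1#)) + - (2ᴷ * z * (v + w))

    private
      -- The solver proves identities without hypotheses. An equation x ≈ y therefore enters as a
      -- multiple of x - y added to the identity, and is dropped afterwards.
      vanish : ∀ {x y} c → x ≈ y → c * (x + - y) ≈ 0#
      vanish {x} {y} c x≈y = begin
        c * (x + - y)  ≈⟨ *-congˡ (+-congʳ x≈y) ⟩
        c * (y + - y)  ≈⟨ *-congˡ (-‿inverseʳ y) ⟩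
        c * 0#         ≈⟨ zeroʳ c ⟩
        0#             ∎

      drop-vanish : ∀ {p q r} → p ≈ q + r → r ≈ 0# → p ≈ q
      drop-vanish {p} {q} {r} p≈q+r r≈0 = trans p≈q+r (trans (+-congˡ r≈0) (+-identityʳ q))

    module _ (qi≈1 : (1# + - (h * z * w)) * i ≈ 1#) where
      -- Put y = z/2. Multiplying the second equation by `i` gives b = i (1 + y a). The second
      -- equation also reads y w b = b - 1 - y a, so the first becomes a (1 - y v - y i + y) = w + i
      -- - 1, where i - 1 = y w i. The identity below packs these substitutions into multiples of
      -- the three hypotheses.
      solution : ∀ {a b} →
        a ≈ w + h * z * (v * a + w * b) → b ≈ 1# + h * z * (a + w * b) →
        z * a * denominator₁ ≈ numerator₁
      solution {a} {b} a≈ b≈ =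
        drop-vanish (drop-vanish (drop-vanish identity
          (vanish (z * (h * z) * (a + w * b)) (sym qi≈1)))
          (vanish (z * (h * z) * w * i) b≈))
          (vanish z a≈)
        where
        identity = solve 6 (λ z v w i a b →
          let y = con ½ :* z in
          z :* a :* (1#′ :- y :* v :- y :* i :+ y)
            := (z :* w :+ (con ½ :* (z :* (z :* 1#′)) :* w) :* i)
               :+ z :* (a :- (w :+ y :* (v :* a :+ w :* b)))
               :+ z :* y :* w :* i :* (b :- (1#′ :+ y :* (a :+ w :* b)))
               :+ z :* y :* (a :+ w :* b) :* (1#′ :- (1#′ :- y :* w) :* i))
          refl z v w i a b

      -- The second fraction is the first one expanded by 4 (1 - z w / 2): this factor cancels the
      -- inner denominator and clears the halves. `denominator₂≈` uses the same factor.
      numerator₂≈ : numerator₁ * (4ᴷ * (1# + - (h * z * w))) ≈ numerator₂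
      numerator₂≈ = drop-vanish identity (vanish (4ᴷ * (h * (z * z) * w)) qi≈1)
        where
        identity = solve 3 (λ z w i →
          let q = 1#′ :- con ½ :* z :* w; 2# = con (ℤ.+ 2 / 1) in
          (z :* w :+ (con ½ :* (z :* (z :* 1#′)) :* w) :* i) :* (con (ℤ.+ 4 / 1) :* q)
            := 2# :* z :* w :* (2# :+ (1#′ :- w) :* z)
               :+ con (ℤ.+ 4 / 1) :* (con ½ :* (z :* z) :* w) :* (q :* i :- 1#′))
          refl z w i

      denominator₂≈ : denominator₁ * (4ᴷ * (1# + - (h * z * w))) ≈ denominator₂
      denominator₂≈ = drop-vanish identity (vanish (4ᴷ * (h * z)) (sym qi≈1))
        where
        identity = solve 4 (λ z v w i →
          let y = con ½ :* z; q = 1#′ :- y :* w; 4# = con (ℤ.+ 4 / 1) in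
          (1#′ :- y :* v :- y :* i :+ y) :* (4# :* q)
            := 4# :+ w :* (v :- 1#′) :* (z :* (z :* 1#′)) :- con (ℤ.+ 2 / 1) :* z :* (v :+ w)
               :+ 4# :* y :* (1#′ :- q :* i))
          refl z v w i

      fractions-≈ : ∀ {d₁⁻¹ d₂⁻¹} → denominator₁ * d₁⁻¹ ≈ 1# → denominator₂ * d₂⁻¹ ≈ 1# →
        numerator₁ * d₁⁻¹ ≈ numerator₂ * d₂⁻¹
      fractions-≈ {d₁⁻¹} d₁ d₂ = x/y-unique d₂ (begin
        numerator₁ * d₁⁻¹ * denominator₂        ≈⟨ *-congˡ denominator₂≈ ⟨
        numerator₁ * d₁⁻¹ * (denominator₁ * q)  ≈⟨ *-assoc (numerator₁ * d₁⁻¹) denominator₁ q ⟨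
        numerator₁ * d₁⁻¹ * denominator₁ * q    ≈⟨ *-congʳ (n/y*y numerator₁ d₁) ⟩
        numerator₁ * q                          ≈⟨ numerator₂≈ ⟩
        numerator₂                              ∎)
        where q = 4ᴷ * (1# + - (h * z * w))

-- Combinatorics of the shuffle and of the game.

module Game where
  open import Data.Bool.Base using (true; false)
  open import Data.List.Base
    using (_∷ʳ_; filter; length; take; drop; head; last; upTo; applyUpTo)
  open import Data.List.Membership.Propositional using (_∈_; _∉_; lose)
  import Data.List.Membership.DecPropositional as DecMembership
  open import Data.List.Membership.Propositional.Properties using (∈-map⁺; ∈-++⁺ˡ; ∈-++⁺ʳ; ∈-++⁻)
  import Data.List.Properties as List
  open import Data.List.Relation.Unary.All as All using (All; []; _∷_)
  import Data.List.Relation.Unary.All.Properties as All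
  open import Data.List.Relation.Unary.AllPairs as AllPairs using (AllPairs; []; _∷_)
  import Data.List.Relation.Unary.AllPairs.Properties as AllPairs
  open import Data.List.Relation.Unary.Any using (here; there)
  open import Data.List.Relation.Unary.Unique.Propositional using (Unique)
  import Data.Integer.Properties as ℤ
  open import Data.Maybe.Base using (just)
  import Data.Maybe.Properties as Maybe
  open import Data.Nat.Base
  open import Data.Nat.Properties
  open import Data.Product.Base using (∃-syntax; swap)
  import Data.Rational.Unnormalised.Base as ℚᵘ
  open import Data.Sum.Base using (_⊎_; inj₁; inj₂; [_,_]′)
  open import Data.Vec.Base using (Vec)
  open import Function.Base using (id)
  open import Function.Bundles using (_⇔_; mk⇔; Equivalence)
  open import Level using (0ℓ)
  open import Relation.Binary.PropositionalEquality
  open import Relation.Nullary.Decidable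
    using (yes; no; does; ¬?; _⊎-dec_; _×-dec_; does-⇔)
  open import Relation.Nullary.Negation using (¬_; contradiction)
  open import Relation.Unary using (Pred; Decidable)
  open import Relation.Unary.Properties using (_∩?_)
  open import Defs using
    ( place; pileFrom; shuffle; count; ℙ[_∣_]
    ; largestUnshown; guess; shown; Correct; correct?; SameShown; sameShown?
    ; successProbability; pureLuck?; certified?; Certified; PureLuck; L; C)

  -- Counting

  private variable
    n : ℕ

  module _ {A : Set} {P : Pred A 0ℓ} (P? : Decidable P) where
    length-filter-map : ∀ {B : Set} (f : B → A) xs →
      length (filter P? (map f xs)) ≡ length (filter (P? ∘ f) xs)
    length-filter-map f []       = refl
    length-filter-map f (x ∷ xs) with does (P? (f x))
    ... | true  = cong suc (length-filter-map f xs)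
    ... | false = length-filter-map f xs

    length-filter-++ : ∀ xs ys →
      length (filter P? (xs ++ ys)) ≡ length (filter P? xs) + length (filter P? ys)
    length-filter-++ xs ys = trans (cong length (List.filter-++ P? xs ys)) (List.length-++ (filter P? xs))

    length-filter-cong : ∀ {Q : Pred A 0ℓ} (Q? : Decidable Q) {xs} →
      All (λ x → P x ⇔ Q x) xs → length (filter P? xs) ≡ length (filter Q? xs)
    length-filter-cong Q? []                    = refl
    length-filter-cong Q? {x ∷ xs} (P⇔Q ∷ rest)
      with does (P? x) | does (Q? x) | does-⇔ P⇔Q (P? x) (Q? x)
    ... | true  | _ | refl = cong suc (length-filter-cong Q? rest)
    ... | false | _ | refl = length-filter-cong Q? rest

    length-filter-split : ∀ {Q : Pred A 0ℓ} (Q? : Decidable Q) xs →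
      length (filter P? xs) ≡ length (filter (P? ∩? Q?) xs) + length (filter (P? ∩? (¬? ∘ Q?)) xs)
    length-filter-split Q? [] = refl
    length-filter-split Q? (x ∷ xs) with does (P? x) | does (Q? x)
    ... | true  | true  = cong suc (length-filter-split Q? xs)
    ... | true  | false = trans (cong suc (length-filter-split Q? xs))
                            (sym (+-suc (length (filter (P? ∩? Q?) xs)) _))
    ... | false | _     = length-filter-split Q? xs

  module _ {P : Pred (Ω (suc n)) 0ℓ} (P? : Decidable P) where
    count-suc : count P? ≡ count (P? ∘ (top ∷_)) + count (P? ∘ (bottom ∷_))
    count-suc = trans (length-filter-++ P? (map (top ∷_) (outcomes n)) _)
      (cong₂ _+_ (length-filter-map P? (top ∷_) (outcomes n)) (length-filter-map P? (bottom ∷_) (outcomes n)))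

  count-cong : {P Q : Pred (Ω n) 0ℓ} (P? : Decidable P) (Q? : Decidable Q) →
    (∀ ω → P ω ⇔ Q ω) → count P? ≡ count Q?
  count-cong {n} P? Q? P⇔Q = length-filter-cong P? Q? (All.universal P⇔Q (outcomes n))

  ∈-outcomes : (ω : Ω n) → ω ∈ outcomes n
  ∈-outcomes []           = here refl
  ∈-outcomes (top    ∷ ω) = ∈-++⁺ˡ (∈-map⁺ (top ∷_) (∈-outcomes ω))
  ∈-outcomes (bottom ∷ ω) = ∈-++⁺ʳ _ (∈-map⁺ (bottom ∷_) (∈-outcomes ω))

  count>0 : {P : Pred (Ω n) 0ℓ} (P? : Decidable P) {ω : Ω n} → P ω → count P? > 0
  count>0 P? {ω} Pω = List.filter-some P? (lose (∈-outcomes ω) Pω)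

  opposite : Side → Side
  opposite top    = bottom
  opposite bottom = top

  opposite-involutive : ∀ s → opposite (opposite s) ≡ s
  opposite-involutive top    = refl
  opposite-involutive bottom = refl

  flip : ℕ → Vec Side n → Vec Side n
  flip _       []       = []
  flip zero    (s ∷ ss) = opposite s ∷ ss
  flip (suc j) (s ∷ ss) = s ∷ flip j ss

  flip-involutive : ∀ j (ss : Vec Side n) → flip j (flip j ss) ≡ ss
  flip-involutive _       []       = refl
  flip-involutive zero    (s ∷ ss) = cong (_∷ ss) (opposite-involutive s)
  flip-involutive (suc j) (s ∷ ss) = cong (s ∷_) (flip-involutive j ss)

  -- `flip j` preserves the uniform distribution: at position 0 it exchanges the two summands of
  -- `count-suc`, and a later position is handled within each of them.
  count-flip : ∀ {P : Pred (Ω n) 0ℓ} (P? : Decidable P) j → count P? ≡ count (P? ∘ flip j)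
  count-flip {zero}  P? j       = count-cong P? (P? ∘ flip j) (λ { [] → mk⇔ id id })
  count-flip {suc n} P? zero    = begin
    count P?                                             ≡⟨ count-suc P? ⟩
    count (P? ∘ (top ∷_)) + count (P? ∘ (bottom ∷_))     ≡⟨ +-comm (count (P? ∘ (top ∷_))) _ ⟩
    count (P? ∘ (bottom ∷_)) + count (P? ∘ (top ∷_))     ≡⟨ count-suc (P? ∘ flip zero) ⟨
    count (P? ∘ flip zero)                               ∎
    where open ≡-Reasoning
  count-flip {suc n} P? (suc j) = begin
    count P?                                             ≡⟨ count-suc P? ⟩
    count (P? ∘ (top ∷_)) + count (P? ∘ (bottom ∷_))
      ≡⟨ cong₂ _+_ (count-flip (P? ∘ (top ∷_)) j) (count-flip (P? ∘ (bottom ∷_)) j) ⟩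
    count (P? ∘ (top ∷_) ∘ flip j) + count (P? ∘ (bottom ∷_) ∘ flip j)
      ≡⟨ count-suc (P? ∘ flip (suc j)) ⟨
    count (P? ∘ flip (suc j))                            ∎
    where open ≡-Reasoning

  module _ {P Q : Pred (Ω n) 0ℓ} (P? : Decidable P) (Q? : Decidable Q) where

    private
      a = count (P? ∩? Q?)

    -- The fraction in `ℙ[_∣_]` is reduced. Passing to unnormalised rationals turns the comparison
    -- into a cross-multiplication, both here and for ½.
    ℙ≡1 : count Q? > 0 → count (P? ∩? Q?) ≡ count Q? → ℙ[ P? ∣ Q? ] ≡ 1ℚ
    ℙ≡1 pos eq with count Q?
    ... | suc m = ℚ.fromℚᵘ-cong {ℚᵘ.mkℚᵘ (ℤ.+ a) m} {ℚᵘ.1ℚᵘ} (ℚᵘ.*≡* (begin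
      ℤ.+ a ℤ.* ℤ.+ 1        ≡⟨ ℤ.*-identityʳ (ℤ.+ a) ⟩
      ℤ.+ a                  ≡⟨ cong ℤ.+_ eq ⟩
      ℤ.+ suc m              ≡⟨ ℤ.*-identityˡ (ℤ.+ suc m) ⟨
      ℤ.+ 1 ℤ.* ℤ.+ suc m    ∎))
      where open ≡-Reasoning

    ℙ≡½ : count Q? > 0 → count Q? ≡ count (P? ∩? Q?) + count (P? ∩? Q?) → ℙ[ P? ∣ Q? ] ≡ ½
    ℙ≡½ pos eq with count Q?
    ... | suc m = ℚ.fromℚᵘ-cong {ℚᵘ.mkℚᵘ (ℤ.+ a) m} {ℚᵘ.½} (ℚᵘ.*≡* (begin
      ℤ.+ a ℤ.* ℤ.+ 2        ≡⟨ ℤ.pos-* a 2 ⟨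
      ℤ.+ (a * 2)            ≡⟨ cong ℤ.+_ (*-comm a 2) ⟩
      ℤ.+ (a + (a + 0))      ≡⟨ cong (λ b → ℤ.+ (a + b)) (+-identityʳ a) ⟩
      ℤ.+ (a + a)            ≡⟨ cong ℤ.+_ eq ⟨
      ℤ.+ suc m              ≡⟨ ℤ.*-identityˡ (ℤ.+ suc m) ⟨
      ℤ.+ 1 ℤ.* ℤ.+ suc m    ∎))
      where open ≡-Reasoning

  open DecMembership _≟_ using (_∈?_)

  -- Piles

  module _ {A : Set} where
    take-++ : ∀ k (xs : List A) {ys} → k ≤ length xs → take k (xs ++ ys) ≡ take k xs
    take-++ zero    xs       _         = refl
    take-++ (suc k) (x ∷ xs) (s≤s k≤n) = cong (x ∷_) (take-++ k xs k≤n)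

    drop-++ : ∀ k (xs : List A) {ys} → k ≤ length xs → drop k (xs ++ ys) ≡ drop k xs ++ ys
    drop-++ zero    xs       _         = refl
    drop-++ (suc k) (x ∷ xs) (s≤s k≤n) = drop-++ k xs k≤n

    head-drop-++ : ∀ k (xs : List A) {ys} → k < length xs → head (drop k (xs ++ ys)) ≡ head (drop k xs)
    head-drop-++ zero    (x ∷ xs) _         = refl
    head-drop-++ (suc k) (x ∷ xs) (s≤s k<n) = head-drop-++ k xs k<n

    drop-nonempty : ∀ k (xs : List A) → k < length xs → ∃[ c ] ∃[ ds ] drop k xs ≡ c ∷ ds
    drop-nonempty zero    (x ∷ xs) _         = x , xs , refl
    drop-nonempty (suc k) (x ∷ xs) (s≤s k<n) = drop-nonempty k xs k<n

    unique-∉ : ∀ xs {y : A} {ys} → Unique (xs ++ y ∷ ys) → y ∉ xs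
    unique-∉ (x ∷ xs) (x≢ ∷ _) (here refl) = All.lookup x≢ (∈-++⁺ʳ xs (here refl)) refl
    unique-∉ (x ∷ xs) (_ ∷ u)  (there y∈)  = unique-∉ xs u y∈

  length-pileFrom : ∀ i (ss : Vec Side n) → length (pileFrom i ss) ≡ n
  length-pileFrom i []            = refl
  length-pileFrom i (top ∷ ss)    = cong suc (length-pileFrom (suc i) ss)
  length-pileFrom i (bottom ∷ ss) = begin
    length (pileFrom (suc i) ss ∷ʳ i)   ≡⟨ List.length-++ (pileFrom (suc i) ss) ⟩
    length (pileFrom (suc i) ss) + 1    ≡⟨ +-comm _ 1 ⟩
    suc (length (pileFrom (suc i) ss))  ≡⟨ cong suc (length-pileFrom (suc i) ss) ⟩
    suc _                               ∎
    where open ≡-Reasoning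

  ∈-pileFrom⁻ : ∀ i (ss : Vec Side n) {x} → x ∈ pileFrom i ss → i ≤ x × x < n + i
  ∈-pileFrom⁻ {suc n} i (s ∷ ss) {x} x∈ = split s x∈
    where
    itself : i ≤ i × i < suc n + i
    itself = ≤-refl , s≤s (m≤n+m i n)

    later : x ∈ pileFrom (suc i) ss → i ≤ x × x < suc n + i
    later x∈ = let i<x , x< = ∈-pileFrom⁻ (suc i) ss x∈ in <⇒≤ i<x , subst (x <_) (+-suc n i) x<

    split : ∀ s → x ∈ place s i (pileFrom (suc i) ss) → i ≤ x × x < suc n + i
    split top    (here refl) = itself
    split top    (there x∈)  = later x∈
    split bottom x∈ with ∈-++⁻ (pileFrom (suc i) ss) x∈
    ... | inj₁ x∈          = later x∈
    ... | inj₂ (here refl) = itself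

  ∈-pileFrom⁺ : ∀ i (ss : Vec Side n) {x} → i ≤ x → x < n + i → x ∈ pileFrom i ss
  ∈-pileFrom⁺ i []       i≤x x<i = contradiction i≤x (<⇒≱ x<i)
  ∈-pileFrom⁺ {suc n} i (s ∷ ss) {x} i≤x x< with m≤n⇒m<n∨m≡n i≤x
  ... | inj₁ i<x  = later s
    where
    x∈ : x ∈ pileFrom (suc i) ss
    x∈ = ∈-pileFrom⁺ (suc i) ss i<x (subst (x <_) (sym (+-suc n i)) x<)

    later : ∀ s → x ∈ place s i (pileFrom (suc i) ss)
    later top    = there x∈
    later bottom = ∈-++⁺ˡ x∈
  ... | inj₂ refl = itself s
    where
    itself : ∀ s → i ∈ place s i (pileFrom (suc i) ss)
    itself top    = here refl
    itself bottom = ∈-++⁺ʳ (pileFrom (suc i) ss) (here refl)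

  later-larger : ∀ i (ss : Vec Side n) → All (_> i) (pileFrom (suc i) ss)
  later-larger i ss = All.tabulate (λ x∈ → proj₁ (∈-pileFrom⁻ (suc i) ss x∈))

  unique-pileFrom : ∀ i (ss : Vec Side n) → Unique (pileFrom i ss)
  unique-pileFrom i []            = []
  unique-pileFrom i (top ∷ ss)    = All.map <⇒≢ (later-larger i ss) ∷ unique-pileFrom (suc i) ss
  unique-pileFrom i (bottom ∷ ss) = AllPairs.++⁺ (unique-pileFrom (suc i) ss) ([] ∷ [])
    (All.map (λ i<x → >⇒≢ i<x ∷ []) (later-larger i ss))

  -- The rest of the pile is nonempty, so the first card comes from it and has a label larger than
  -- i. In an otherwise empty pile the bottom card would be first as well.
  bottom-not-first : ∀ i (ss : Vec Side (suc n)) → head (pileFrom i (bottom ∷ ss)) ≢ just i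
  bottom-not-first i ss eq with pileFrom (suc i) ss | length-pileFrom (suc i) ss | later-larger i ss
  ... | x ∷ _ | _ | i<x ∷ _ = >⇒≢ i<x (Maybe.just-injective eq)

  -- The guessing game

  Seen : ℕ → List ℕ → Set
  Seen n cs = (n ∸ 1 ∈ cs) ⊎ (n ∈ cs)

  seen? : ∀ n → Decidable (Seen n)
  seen? n cs = (n ∸ 1 ∈? cs) ⊎-dec (n ∈? cs)

  -- `prev` stands for the card shown just before the list. Starting with 0 makes the first guess,
  -- card 1, an instance of the successor rule.
  lastOr : ℕ → List ℕ → ℕ
  lastOr prev []       = prev
  lastOr prev (c ∷ cs) = lastOr c cs

  last-∷ : ∀ c cs → last (c ∷ cs) ≡ just (lastOr c cs)
  last-∷ c []        = refl
  last-∷ c (c′ ∷ cs) = last-∷ c′ cs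

  lastOr-take : ∀ p q k (xs : List ℕ) → k < length xs →
    lastOr p (take (suc k) xs) ≡ lastOr q (take (suc k) xs)
  lastOr-take p q k (x ∷ xs) _ = refl

  guess-seen : ∀ {n} cs → Seen n cs → guess n cs ≡ largestUnshown n cs
  guess-seen {n} cs seen with seen? n cs | last cs
  ... | yes _    | _ = refl
  ... | no ¬seen | _ = contradiction seen ¬seen

  guess-unseen : ∀ {n} cs → ¬ Seen n cs → guess n cs ≡ suc (lastOr 0 cs)
  guess-unseen {n} [] ¬seen with seen? n []
  ... | yes seen = contradiction seen ¬seen
  ... | no _     = refl
  guess-unseen {n} (c ∷ cs) ¬seen with seen? n (c ∷ cs) | last (c ∷ cs) | last-∷ c cs
  ... | yes seen | _ | _    = contradiction seen ¬seen
  ... | no _     | _ | refl = refl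

  largestUnshown-≡ : ∀ m cs {c} → 1 ≤ c → c ≤ m → c ∉ cs → (∀ x → c < x → x ≤ m → x ∈ cs) →
    largestUnshown m cs ≡ c
  largestUnshown-≡ zero    cs 1≤c c≤0 c∉ larger = contradiction (≤-trans 1≤c c≤0) λ ()
  largestUnshown-≡ (suc m) cs 1≤c c≤m c∉ larger with suc m ∈? cs | m≤n⇒m<n∨m≡n c≤m
  ... | yes _   | inj₁ c<   = largestUnshown-≡ m cs 1≤c (≤-pred c<) c∉ (λ x c<x x≤m → larger x c<x (m≤n⇒m≤1+n x≤m))
  ... | yes m∈  | inj₂ refl = contradiction m∈ c∉
  ... | no m∉   | inj₁ c<   = contradiction (larger (suc m) c< ≤-refl) m∉
  ... | no _    | inj₂ refl = refl

  -- The pile holds the labels i to n, with n fixed throughout the recursion. If card i is on top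
  -- and is itself n - 1 or n, at most one card remains. If it is at the bottom, it is smaller than
  -- all cards above it and extends a descending remainder.
  descending-after-seen : ∀ {l} i (ss : Vec Side l) → l + i ≡ suc n → ∀ k →
    Seen n (take k (pileFrom i ss)) → AllPairs _>_ (drop k (pileFrom i ss))
  descending-after-seen i [] _ k _ = subst (AllPairs _>_) (sym (List.drop-[] k)) []
  descending-after-seen i (top ∷ ss) eq zero (inj₁ ())
  descending-after-seen i (top ∷ ss) eq zero (inj₂ ())
  descending-after-seen {n} {suc l} i (top ∷ ss) eq (suc k) seen = continue seen
    where
    rest = pileFrom (suc i) ss

    short : ∀ xs → length xs ≤ 1 → AllPairs _>_ xs
    short []          _        = []
    short (x ∷ [])    _        = [] ∷ []
    short (x ∷ y ∷ _) (s≤s ())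

    drop-short : l ≤ 1 → AllPairs _>_ (drop k rest)
    drop-short l≤1 = AllPairs.drop⁺ k (short rest (subst (_≤ 1) (sym (length-pileFrom (suc i) ss)) l≤1))

    l≤1 : ∀ l → l + i ≡ n → n ∸ 1 ≡ i → l ≤ 1
    l≤1 zero          _    _  = z≤n
    l≤1 (suc zero)    _    _  = ≤-refl
    l≤1 (suc (suc l)) refl n-1≡i = contradiction (sym n-1≡i) (<⇒≢ (s≤s (m≤n+m i l)))

    l≤1′ : ∀ l → l + i ≡ n → n ≡ i → l ≤ 1
    l≤1′ zero    _    _   = z≤n
    l≤1′ (suc l) refl n≡i = contradiction (sym n≡i) (<⇒≢ (s≤s (m≤n+m i l)))

    continue : Seen n (i ∷ take k rest) → AllPairs _>_ (drop k rest)
    continue (inj₁ (here n-1≡i)) = drop-short (l≤1 l (suc-injective eq) n-1≡i)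
    continue (inj₂ (here n≡i))   = drop-short (l≤1′ l (suc-injective eq) n≡i)
    continue (inj₁ (there n-1∈)) = descending-after-seen (suc i) ss (trans (+-suc l i) eq) k (inj₁ n-1∈)
    continue (inj₂ (there n∈))   = descending-after-seen (suc i) ss (trans (+-suc l i) eq) k (inj₂ n∈)
  descending-after-seen {n} {suc l} i (bottom ∷ ss) eq k seen with k ≤? length (pileFrom (suc i) ss)
  ... | no k≰ = subst (AllPairs _>_) (sym (List.drop-all k (rest ∷ʳ i) len≤k)) []
    where
    rest = pileFrom (suc i) ss

    len≤k : length (rest ∷ʳ i) ≤ k
    len≤k = subst (_≤ k) (sym (trans (List.length-++ rest) (+-comm (length rest) 1))) (≰⇒> k≰)
  ... | yes k≤ = subst (AllPairs _>_) (sym (drop-++ k rest k≤)) (AllPairs.++⁺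
      (descending-after-seen (suc i) ss (trans (+-suc l i) eq) k (subst (Seen n) (take-++ k rest k≤) seen))
      ([] ∷ [])
      (All.map (_∷ []) (All.drop⁺ k (later-larger i ss))))
    where rest = pileFrom (suc i) ss

  correct-after-seen : ∀ (ω : Ω n) {k} → k < n → Seen n (shown k ω) → Correct k ω
  correct-after-seen {n} ω {k} k<n seen
    with c , ds , drop≡ ← drop-nonempty k (shuffle ω) (subst (k <_) (sym (length-pileFrom 1 ω)) k<n) = begin
    head (drop k (shuffle ω))           ≡⟨ cong head drop≡ ⟩
    just c                              ≡⟨ cong just (largestUnshown-≡ n cs 1≤c c≤n c∉cs larger) ⟨
    just (largestUnshown n cs)          ≡⟨ cong just (guess-seen cs seen) ⟨
    just (guess n cs)                   ∎
    where
    open ≡-Reasoning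
    cs = shown k ω

    pile≡ : cs ++ c ∷ ds ≡ shuffle ω
    pile≡ = trans (cong (cs ++_) (sym drop≡)) (List.take++drop≡id k (shuffle ω))

    bounds : 1 ≤ c × c < n + 1
    bounds = ∈-pileFrom⁻ 1 ω (subst (c ∈_) pile≡ (∈-++⁺ʳ cs (here refl)))

    1≤c = proj₁ bounds
    c≤n : c ≤ n
    c≤n = ≤-pred (subst (c <_) (+-comm n 1) (proj₂ bounds))

    c∉cs : c ∉ cs
    c∉cs = unique-∉ cs (subst Unique (sym pile≡) (unique-pileFrom 1 ω))

    descending : AllPairs _>_ (c ∷ ds)
    descending = subst (AllPairs _>_) drop≡ (descending-after-seen 1 ω (+-comm n 1) k seen)

    larger : ∀ x → c < x → x ≤ n → x ∈ cs
    larger x c<x x≤n with ∈-++⁻ cs (subst (x ∈_) (sym pile≡)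
      (∈-pileFrom⁺ 1 ω (≤-trans 1≤c (<⇒≤ c<x)) (subst (x <_) (+-comm 1 n) (s≤s x≤n))))
    ... | inj₁ x∈          = x∈
    ... | inj₂ (here refl) = contradiction c<x (n≮n c)
    ... | inj₂ (there x∈)  = contradiction c<x (<⇒≯ (All.lookup (AllPairs.head descending) x∈))

  -- Correctness under the successor rule, relative to a pile `xs` shown after the card `prev`. The
  -- extra parameter allows recursion on piles of the larger labels.
  Hit : ℕ → List ℕ → ℕ → Set
  Hit prev xs k = head (drop k xs) ≡ just (suc (lastOr prev (take k xs)))

  Hit-++ : ∀ prev xs {ys} k → k < length xs → Hit prev (xs ++ ys) k ≡ Hit prev xs k
  Hit-++ prev xs k k<n = cong₂ (λ m cs → m ≡ just (suc (lastOr prev cs)))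
    (head-drop-++ k xs k<n) (take-++ k xs (<⇒≤ k<n))

  Hit-prev : ∀ p q xs k → k < length xs → Hit p xs (suc k) ≡ Hit q xs (suc k)
  Hit-prev p q xs k k<n = cong (λ c → head (drop (suc k) xs) ≡ just (suc c)) (lastOr-take p q k xs k<n)

  Flips : ℕ → Vec Side n → ℕ → Set
  Flips prev ss k = ∃[ j ]
    j + suc prev ≡ suc (lastOr prev (take k xs)) ×
    take k (pileFrom (suc prev) (flip j ss)) ≡ take k xs ×
    (Hit prev (pileFrom (suc prev) (flip j ss)) k ⇔ (¬ Hit prev xs k))
    where xs = pileFrom (suc prev) ss

  -- While neither n - 1 nor n has been shown, the side of the guessed card alone
  -- decides whether the guess is correct, and it does not affect the cards shown.
  -- The witness j is the position of the guessed card.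
  flips : ∀ {l} prev (ss : Vec Side l) → l + suc prev ≡ suc n → ∀ k → k < l → 2 ≤ l →
    ¬ Seen n (take k (pileFrom (suc prev) ss)) → Flips prev ss k
  flips prev (_ ∷ []) eq zero _ (s≤s ()) _
  flips prev (top ∷ ss@(_ ∷ _)) eq zero _ _ _ =
    0 , refl , refl ,
    mk⇔ (λ hit → contradiction hit (bottom-not-first (suc prev) ss)) (λ ¬hit → contradiction refl ¬hit)
  flips prev (bottom ∷ ss@(_ ∷ _)) eq zero _ _ _ =
    0 , refl , refl , mk⇔ (λ _ → bottom-not-first (suc prev) ss) (λ _ → refl)
  flips {n} {suc l} prev (top ∷ ss) eq (suc k) (s≤s k<l) _ ¬seen
    = let j , j≡ , take≡ , hit⇔ = flips (suc prev) ss eq′ k k<l 2≤l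
            (¬seen ∘ [ inj₁ ∘ there , inj₂ ∘ there ]′)
      in suc j , trans (sym (+-suc j (suc prev))) j≡ , cong (suc prev ∷_) take≡ , hit⇔
    where
    eq′ : l + suc (suc prev) ≡ suc n
    eq′ = trans (+-suc l (suc prev)) eq

    -- With a single card left, the shown card `suc prev` would be n - 1.
    2≤l : 2 ≤ l
    2≤l with m≤n⇒m<n∨m≡n (≤-trans (s≤s z≤n) k<l)
    ... | inj₁ 1<l  = 1<l
    ... | inj₂ refl = contradiction (inj₁ (here (cong pred (sym (suc-injective eq))))) ¬seen
  flips {n} {suc l} prev (bottom ∷ ss) eq (suc k) (s≤s k<l) _ ¬seen
    -- At least one card of the rest has been shown, so the last shown card is the same for either
    -- initial value. Hence the recursion may start from `suc prev` although that card lies at the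
    -- bottom.
    = let j , j≡ , take≡ , hit⇔ = flips (suc prev) ss eq′ (suc k) k+1<l (≤-trans (s≤s (s≤s z≤n)) k+1<l)
            (¬seen ∘ subst (Seen n) (sym (take-xs ss)))
      in suc j
    , (begin
        suc j + suc prev                            ≡⟨ +-suc j (suc prev) ⟨
        j + suc (suc prev)                          ≡⟨ j≡ ⟩
        suc (lastOr (suc prev) (take (suc k) (xs ss)))  ≡⟨ cong suc (lastOr-take (suc prev) prev k (xs ss) (k<len ss)) ⟩
        suc (lastOr prev (take (suc k) (xs ss)))        ≡⟨ cong (suc ∘ lastOr prev) (take-xs ss) ⟨
        suc (lastOr prev (take (suc k) (xs ss ∷ʳ suc prev)))  ∎)
    , trans (take-xs (flip j ss)) (trans take≡ (sym (take-xs ss)))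
    , subst₂ (λ A B → A ⇔ (¬ B)) (sym (Hit-xs (flip j ss))) (sym (Hit-xs ss)) hit⇔
    where
    open ≡-Reasoning
    xs : Vec Side l → List ℕ
    xs ss = pileFrom (suc (suc prev)) ss

    eq′ : l + suc (suc prev) ≡ suc n
    eq′ = trans (+-suc l (suc prev)) eq

    k<len : ∀ ss → k < length (xs ss)
    k<len ss = subst (k <_) (sym (length-pileFrom _ ss)) k<l

    take-xs : ∀ ss → take (suc k) (xs ss ∷ʳ suc prev) ≡ take (suc k) (xs ss)
    take-xs ss = take-++ (suc k) (xs ss) (k<len ss)

    n∈xs : n ∈ xs ss
    n∈xs = ∈-pileFrom⁺ (suc (suc prev)) ss
      (subst (suc (suc prev) ≤_) (suc-injective eq) (+-monoˡ-≤ (suc prev) (≤-trans (s≤s z≤n) k<l)))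
      (subst (n <_) (sym eq′) (n<1+n n))

    -- Otherwise all cards above `suc prev` have been shown, and n is one of them.
    k+1<l : suc k < l
    k+1<l with m≤n⇒m<n∨m≡n k<l
    ... | inj₁ k+1<l = k+1<l
    ... | inj₂ refl  = contradiction (inj₂ (subst (n ∈_) (sym (trans (take-xs ss) take-all)) n∈xs)) ¬seen
      where
      take-all : take (suc k) (xs ss) ≡ xs ss
      take-all = List.take-all (suc k) (xs ss) (≤-reflexive (length-pileFrom _ ss))

    Hit-xs : ∀ ss → Hit prev (xs ss ∷ʳ suc prev) (suc k) ≡ Hit (suc prev) (xs ss) (suc k)
    Hit-xs ss = trans (Hit-++ prev (xs ss) (suc k) k+1<len) (Hit-prev prev (suc prev) (xs ss) k (k<len ss))
      where
      k+1<len : suc k < length (xs ss)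
      k+1<len = subst (suc k <_) (sym (length-pileFrom _ ss)) k+1<l

  -- Success probabilities and the type of a guess.

  sameShown>0 : ∀ k (ω : Ω n) → count (sameShown? k ω) > 0
  sameShown>0 k ω = count>0 (sameShown? k ω) {ω} refl

  module _ (ω : Ω n) {k} (k<n : k < n) where

    -- `Seen` depends on the shown cards only, so it holds in every outcome of the conditioning
    -- event, and the guess is correct in all of them.
    certain-after-seen : Seen n (shown k ω) → successProbability k ω ≡ 1ℚ
    certain-after-seen seen = ℙ≡1 (correct? k) (sameShown? k ω) (sameShown>0 k ω)
      (count-cong (correct? k ∩? sameShown? k ω) (sameShown? k ω) λ ω′ → mk⇔ proj₂
        (λ same → correct-after-seen ω′ k<n (subst (Seen n) (sym same) seen) , same))

    module _ (2≤n : 2 ≤ n) (¬seen : ¬ Seen n (shown k ω)) where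

      correct⇔hit : ∀ ω′ → SameShown k ω ω′ → Correct k ω′ ⇔ Hit 0 (shuffle ω′) k
      correct⇔hit ω′ same = mk⇔ (λ c → trans c (cong just eq)) (λ h → trans h (cong just (sym eq)))
        where
        eq : guess n (shown k ω′) ≡ suc (lastOr 0 (shown k ω′))
        eq = guess-unseen (shown k ω′) (¬seen ∘ subst (Seen n) same)

      private
        -- Labels start at 1 and positions at 0, so the guessed card `suc j` has position j.
        j = lastOr 0 (shown k ω)

      -- The position supplied by `flips` is determined by the shown cards, so one and the same
      -- involution `flip j` serves the whole conditioning event.
      flip-hit : ∀ ω′ → SameShown k ω ω′ →
        SameShown k ω (flip j ω′) × (Hit 0 (shuffle (flip j ω′)) k ⇔ (¬ Hit 0 (shuffle ω′) k))
      flip-hit ω′ same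
        with j′ , j′≡ , take≡ , hit⇔ ← flips 0 ω′ (+-comm n 1) k k<n 2≤n (¬seen ∘ subst (Seen n) same)
        rewrite trans (suc-injective (trans (+-comm 1 j′) j′≡)) (cong (lastOr 0) same)
        = trans take≡ same , hit⇔

      flip-correct : ∀ ω′ → SameShown k ω ω′ →
        SameShown k ω (flip j ω′) × (Correct k (flip j ω′) ⇔ (¬ Correct k ω′))
      flip-correct ω′ same =
        let same′ , hit⇔ = flip-hit ω′ same
            module A = Equivalence (correct⇔hit ω′ same)
            module B = Equivalence (correct⇔hit (flip j ω′) same′)
            module H = Equivalence hit⇔
        in same′ , mk⇔ (λ c → H.to (B.to c) ∘ A.to) (λ ¬c → B.from (H.from (¬c ∘ A.from)))

      -- Within the conditioning event, `flip j` exchanges the outcomes with a correct guess and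
      -- those with a wrong one, so each kind makes up half of it.
      even-before-seen : successProbability k ω ≡ ½
      even-before-seen = ℙ≡½ (correct? k) (sameShown? k ω) (sameShown>0 k ω) (begin
        count same?
          ≡⟨ length-filter-split same? (correct? k) (outcomes n) ⟩
        count (same? ∩? correct? k) + count (same? ∩? (¬? ∘ correct? k))
          ≡⟨ cong₂ _+_
               (count-cong (same? ∩? correct? k) both? λ _ → mk⇔ swap swap)
               (count-cong (same? ∩? (¬? ∘ correct? k)) (both? ∘ flip j) λ ω′ → mk⇔ (to ω′) (from ω′)) ⟩
        count both? + count (both? ∘ flip j)
          ≡⟨ cong (count both? +_) (count-flip both? j) ⟨
        count both? + count both?
          ∎)
        where
        open ≡-Reasoning
        same? = sameShown? k ω
        both? = correct? k ∩? sameShown? k ω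

        to : ∀ ω′ → SameShown k ω ω′ × ¬ Correct k ω′ → Correct k (flip j ω′) × SameShown k ω (flip j ω′)
        to ω′ (same , ¬c) =
          let same′ , c⇔ = flip-correct ω′ same in Equivalence.from c⇔ ¬c , same′

        from : ∀ ω′ → Correct k (flip j ω′) × SameShown k ω (flip j ω′) → SameShown k ω ω′ × ¬ Correct k ω′
        from ω′ (c , same) =
          -- `flip j` is its own inverse: applied to `flip j ω′` it shows that ω′ has the same shown
          -- cards.
          let same′ , c⇔ = flip-correct (flip j ω′) same
              same″ = subst (SameShown k ω) (flip-involutive j ω′) same′
          in same″ , Equivalence.to (proj₂ (flip-correct ω′ same″)) c

  EarlyHit : ℕ → ℕ → List ℕ → Pred ℕ 0ℓ
  EarlyHit n prev xs k = ¬ Seen n (take k xs) × Hit prev xs k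

  earlyHit? : ∀ n prev xs → Decidable (EarlyHit n prev xs)
  earlyHit? n prev xs k =
    ¬? (seen? n (take k xs)) ×-dec Maybe.≡-dec _≟_ (head (drop k xs)) (just (suc (lastOr prev (take k xs))))

  seenAt? : ∀ n (xs : List ℕ) → Decidable (λ k → Seen n (take k xs))
  seenAt? n xs k = seen? n (take k xs)

  1ℚ≢½ : 1ℚ ≢ ½
  1ℚ≢½ ()

  module _ (2≤n : 2 ≤ n) (ω : Ω n) where
    -- The success probability is 1 once n - 1 or n is seen and ½ before, so `Seen` alone decides
    -- the type of a correct guess.
    pureLuck⇔ : ∀ {k} → k < n → PureLuck ω k ⇔ EarlyHit n 0 (shuffle ω) k
    pureLuck⇔ {k} k<n = mk⇔ to from
      where
      to : PureLuck ω k → EarlyHit n 0 (shuffle ω) k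
      to (c , p≡½) = ¬seen , Equivalence.to (correct⇔hit ω k<n 2≤n ¬seen ω refl) c
        where
        ¬seen : ¬ Seen n (shown k ω)
        ¬seen seen = 1ℚ≢½ (trans (sym (certain-after-seen ω k<n seen)) p≡½)

      from : EarlyHit n 0 (shuffle ω) k → PureLuck ω k
      from (¬seen , hit) =
        Equivalence.from (correct⇔hit ω k<n 2≤n ¬seen ω refl) hit , even-before-seen ω k<n 2≤n ¬seen

    certified⇔ : ∀ {k} → k < n → Certified ω k ⇔ Seen n (shown k ω)
    certified⇔ {k} k<n = mk⇔ to (λ seen → correct-after-seen ω k<n seen , certain-after-seen ω k<n seen)
      where
      to : Certified ω k → Seen n (shown k ω)
      to (_ , p≡1) with seen? n (shown k ω)
      ... | yes seen = seen
      ... | no ¬seen = contradiction (trans (sym p≡1) (even-before-seen ω k<n 2≤n ¬seen)) 1ℚ≢½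

  -- The numbers of guesses of both types, read off from the sides.

  module _ {P : Pred ℕ 0ℓ} (P? : Decidable P) where
    countBelow : ℕ → ℕ
    countBelow m = length (filter P? (upTo m))

    countBelow-∷ʳ : ∀ m → countBelow (suc m) ≡ countBelow m + length (filter P? (m ∷ []))
    countBelow-∷ʳ m = trans (cong (length ∘ filter P?) (sym (List.upTo-∷ʳ m)))
      (length-filter-++ P? (upTo m) (m ∷ []))

    countBelow-cong : ∀ {Q : Pred ℕ 0ℓ} (Q? : Decidable Q) m →
      (∀ {k} → k < m → P k ⇔ Q k) → countBelow m ≡ length (filter Q? (upTo m))
    countBelow-cong Q? m P⇔Q = length-filter-cong P? Q? (All.applyUpTo⁺₁ id m P⇔Q)

  countBelow-∷ : ∀ {P : Pred ℕ 0ℓ} (P? : Decidable P) m →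
    countBelow P? (suc m) ≡ length (filter P? (0 ∷ [])) + countBelow (P? ∘ suc) m
  countBelow-∷ P? m = begin
    countBelow P? (suc m)
      ≡⟨ length-filter-++ P? (0 ∷ []) (applyUpTo suc m) ⟩
    length (filter P? (0 ∷ [])) + length (filter P? (applyUpTo suc m))
      ≡⟨ cong (λ xs → length (filter P? (0 ∷ [])) + length (filter P? xs)) (List.map-upTo suc m) ⟨
    length (filter P? (0 ∷ [])) + length (filter P? (map suc (upTo m)))
      ≡⟨ cong (length (filter P? (0 ∷ [])) +_) (length-filter-map P? suc (upTo m)) ⟩
    length (filter P? (0 ∷ [])) + countBelow (P? ∘ suc) m
      ∎
    where open ≡-Reasoning

  module _ {A : Set} {P : Pred A 0ℓ} (P? : Decidable P) where
    one : ∀ x → P x → length (filter P? (x ∷ [])) ≡ 1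
    one x p = cong length (List.filter-accept P? p)

    none : ∀ x → ¬ P x → length (filter P? (x ∷ [])) ≡ 0
    none x ¬p = cong length (List.filter-reject P? ¬p)

  -- The first argument is the side of the card preceding the vector; the side of card n,
  -- the last one, is irrelevant.
  luck cert : Side → Vec Side (suc n) → ℕ
  luck _      (_ ∷ [])              = 0
  luck top    (top ∷ ss@(_ ∷ _))    = suc (luck top ss)
  luck bottom (top ∷ ss@(_ ∷ _))    = luck top ss
  luck _      (bottom ∷ ss@(_ ∷ _)) = luck bottom ss

  cert top    (_ ∷ [])              = 1
  cert bottom (_ ∷ [])              = 0
  cert _      (top ∷ ss@(_ ∷ _))    = cert top ss
  cert _      (bottom ∷ ss@(_ ∷ _)) = suc (cert bottom ss)

  -- Translates the side of card i - 1 into the last card shown before the cards from i on: that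
  -- card is i - 1 itself if i - 1 is on top, and a smaller one if i - 1 is at the bottom. Card 0
  -- counts as on top.
  data LastShown (prev i : ℕ) : Side → Set where
    previous : suc prev ≡ i → LastShown prev i top
    earlier  : suc prev < i → LastShown prev i bottom

  LastShown-< : ∀ {prev i p} → LastShown prev i p → prev < i
  LastShown-< (previous eq) = ≤-reflexive eq
  LastShown-< (earlier lt)  = <⇒≤ lt

  ¬Seen-[] : ¬ Seen n []
  ¬Seen-[] (inj₁ ())
  ¬Seen-[] (inj₂ ())

  module _ {n m : ℕ} {i : ℕ} (ss : Vec Side (suc m)) (eq : suc m + i ≡ n) where
    private
      rest = pileFrom (suc i) ss

      m+i<n : m + i < n
      m+i<n = ≤-reflexive eq

      len≡ : length rest ≡ suc m
      len≡ = length-pileFrom (suc i) ss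

    earlyHit-bottom : ∀ prev {k} → k < suc m →
      EarlyHit n prev (rest ∷ʳ i) k ⇔ EarlyHit n prev rest k
    earlyHit-bottom prev {k} k< = subst (λ A → EarlyHit n prev (rest ∷ʳ i) k ⇔ A) same (mk⇔ id id)
      where
      k<len = subst (k <_) (sym len≡) k<
      same : EarlyHit n prev (rest ∷ʳ i) k ≡ EarlyHit n prev rest k
      same = cong₂ (λ cs A → ¬ Seen n cs × A) (take-++ k rest (<⇒≤ k<len)) (Hit-++ prev rest k k<len)

    seen-bottom : ∀ {k} → k < suc m → Seen n (take k (rest ∷ʳ i)) ⇔ Seen n (take k rest)
    seen-bottom {k} k< = subst (λ cs → Seen n (take k (rest ∷ʳ i)) ⇔ Seen n cs)
      (take-++ k rest (<⇒≤ (subst (k <_) (sym len≡) k<))) (mk⇔ id id)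

    -- The cards above the bottom card i are those with labels i + 1 to n, so the guess of i itself
    -- comes after n.
    seen-all : Seen n (take (suc m) (rest ∷ʳ i))
    seen-all = inj₂ (subst (n ∈_) (sym eq′) (∈-pileFrom⁺ (suc i) ss
      (≤-trans (s≤s (m≤n+m i m)) m+i<n)
      (≤-reflexive (cong suc (sym (trans (+-suc m i) eq))))))
      where
      eq′ : take (suc m) (rest ∷ʳ i) ≡ rest
      eq′ = trans (take-++ (suc m) rest (≤-reflexive (sym len≡)))
              (List.take-all (suc m) rest (≤-reflexive len≡))

    -- The bound on m gives i < n - 1, so showing card i does not yet end the phase of pure luck.
    seen-top : 1 ≤ m → ∀ {k} → Seen n (take (suc k) (i ∷ rest)) ⇔ Seen n (take k rest)
    seen-top 1≤m {k} = mk⇔ to [ inj₁ ∘ there , inj₂ ∘ there ]′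
      where
      i<n-1 : i < n ∸ 1
      i<n-1 = subst (λ n → i < n ∸ 1) eq (+-monoˡ-≤ i 1≤m)

      to : Seen n (i ∷ take k rest) → Seen n (take k rest)
      to (inj₁ (here n-1≡i)) = contradiction (sym n-1≡i) (<⇒≢ i<n-1)
      to (inj₁ (there n-1∈)) = inj₁ n-1∈
      to (inj₂ (here n≡i))   = contradiction (sym n≡i) (<⇒≢ (<-≤-trans i<n-1 (m∸n≤m n 1)))
      to (inj₂ (there n∈))   = inj₂ n∈

  seen-penultimate : ∀ {n i} cs → suc i ≡ n → Seen n (i ∷ cs)
  seen-penultimate cs refl = inj₁ (here refl)

  -- Recursion on the side of card i < n. At the bottom it is drawn last, after n, and contributes
  -- nothing. On top it is drawn first and is hit exactly if `prev` is i - 1.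
  countBelow-luck : ∀ {n m prev i p} (ss : Vec Side (suc (suc m))) → suc m + i ≡ n →
    LastShown prev i p → countBelow (earlyHit? n prev (pileFrom i ss)) (suc (suc m)) ≡ luck p ss
  countBelow-luck {n} {m} {prev} {i} {p} (bottom ∷ ss) eq last = begin
    countBelow P? (suc (suc m))
      ≡⟨ countBelow-∷ʳ P? (suc m) ⟩
    countBelow P? (suc m) + length (filter P? (suc m ∷ []))
      ≡⟨ cong₂ _+_
           (countBelow-cong P? (earlyHit? n prev (pileFrom (suc i) ss)) (suc m) (earlyHit-bottom ss eq prev))
           (none P? (suc m) (λ (¬seen , _) → ¬seen (seen-all ss eq))) ⟩
    countBelow (earlyHit? n prev (pileFrom (suc i) ss)) (suc m) + 0
      ≡⟨ +-identityʳ _ ⟩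
    countBelow (earlyHit? n prev (pileFrom (suc i) ss)) (suc m)
      ≡⟨ rest ss eq p ⟩
    luck p (bottom ∷ ss)
      ∎
    where
    open ≡-Reasoning
    P? = earlyHit? n prev (pileFrom i (bottom ∷ ss))

    -- The only remaining card is i + 1 = n, whereas the guess `suc prev` is at most i.
    miss : ∀ s → ¬ EarlyHit n prev (pileFrom (suc i) (s ∷ [])) 0
    miss top    (_ , hit) = <⇒≢ (s≤s (LastShown-< last)) (sym (Maybe.just-injective hit))
    miss bottom (_ , hit) = <⇒≢ (s≤s (LastShown-< last)) (sym (Maybe.just-injective hit))

    rest : ∀ {m} (ss : Vec Side (suc m)) → suc m + i ≡ n → ∀ p →
      countBelow (earlyHit? n prev (pileFrom (suc i) ss)) (suc m) ≡ luck p (bottom ∷ ss)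
    rest {zero}  (s ∷ [])       eq top    = none (earlyHit? n prev (pileFrom (suc i) (s ∷ []))) 0 (miss s)
    rest {zero}  (s ∷ [])       eq bottom = none (earlyHit? n prev (pileFrom (suc i) (s ∷ []))) 0 (miss s)
    rest {suc m} ss@(_ ∷ _ ∷ _) eq top    =
      countBelow-luck ss (trans (+-suc (suc m) i) eq) (earlier (s≤s (LastShown-< last)))
    rest {suc m} ss@(_ ∷ _ ∷ _) eq bottom =
      countBelow-luck ss (trans (+-suc (suc m) i) eq) (earlier (s≤s (LastShown-< last)))
  countBelow-luck {n} {m} {prev} {i} {p} (top ∷ ss) eq last = begin
    countBelow P? (suc (suc m))
      ≡⟨ countBelow-∷ P? (suc m) ⟩
    length (filter P? (0 ∷ [])) + countBelow (P? ∘ suc) (suc m)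
      ≡⟨ cong (length (filter P? (0 ∷ [])) +_) (rest ss eq) ⟩
    length (filter P? (0 ∷ [])) + luck top ss
      ≡⟨ first last ss ⟩
    luck p (top ∷ ss)
      ∎
    where
    open ≡-Reasoning
    P? = earlyHit? n prev (pileFrom i (top ∷ ss))

    first : ∀ {p m} → LastShown prev i p → (ss : Vec Side (suc m)) →
      length (filter P? (0 ∷ [])) + luck top ss ≡ luck p (top ∷ ss)
    first (previous eq) (s ∷ ss) = cong (_+ luck top (s ∷ ss)) (one P? 0 (¬Seen-[] , cong just (sym eq)))
    first (earlier lt)  (s ∷ ss) =
      cong (_+ luck top (s ∷ ss)) (none P? 0 (λ (_ , hit) → >⇒≢ lt (Maybe.just-injective hit)))

    rest : ∀ {m} (ss : Vec Side (suc m)) → suc m + i ≡ n →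
      countBelow (earlyHit? n prev (i ∷ pileFrom (suc i) ss) ∘ suc) (suc m) ≡ luck top ss
    rest {zero}  (s ∷ [])       eq =
      -- Here i is n - 1 and has been shown, so the guess at card n is no longer luck.
      none (earlyHit? n prev (i ∷ pileFrom (suc i) (s ∷ [])) ∘ suc) 0 (λ (¬seen , _) → ¬seen (seen-penultimate [] eq))
    rest {suc m} ss@(_ ∷ _ ∷ _) eq = trans
      (countBelow-cong (earlyHit? n prev (i ∷ pileFrom (suc i) ss) ∘ suc) (earlyHit? n i (pileFrom (suc i) ss))
        (suc (suc m)) λ _ → let module E = Equivalence (seen-top ss eq (s≤s z≤n)) in
          mk⇔ (λ (¬seen , hit) → ¬seen ∘ E.from , hit) (λ (¬seen , hit) → ¬seen ∘ E.to , hit))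
      (countBelow-luck ss (trans (+-suc (suc m) i) eq) (previous refl))

  -- A card i < n at the bottom is drawn after n and is certified; on top it is drawn before n - 1
  -- or n is seen. Card n is certified exactly if n - 1 is on top and thus shown before it.
  countBelow-cert : ∀ {n m i} p (ss : Vec Side (suc (suc m))) → suc m + i ≡ n →
    countBelow (seenAt? n (pileFrom i ss)) (suc (suc m)) ≡ cert p ss
  countBelow-cert {n} {m} {i} p (bottom ∷ ss) eq = begin
    countBelow P? (suc (suc m))
      ≡⟨ countBelow-∷ʳ P? (suc m) ⟩
    countBelow P? (suc m) + length (filter P? (suc m ∷ []))
      ≡⟨ cong₂ _+_
           (countBelow-cong P? (seenAt? n (pileFrom (suc i) ss)) (suc m) (seen-bottom ss eq))
           (one P? (suc m) (seen-all ss eq)) ⟩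
    countBelow (seenAt? n (pileFrom (suc i) ss)) (suc m) + 1
      ≡⟨ +-comm _ 1 ⟩
    suc (countBelow (seenAt? n (pileFrom (suc i) ss)) (suc m))
      ≡⟨ cong suc (rest ss eq) ⟩
    suc (cert bottom ss)
      ≡⟨ cert-bottom p ss ⟩
    cert p (bottom ∷ ss)
      ∎
    where
    open ≡-Reasoning
    P? = seenAt? n (pileFrom i (bottom ∷ ss))

    cert-bottom : ∀ {m} p (ss : Vec Side (suc m)) → suc (cert bottom ss) ≡ cert p (bottom ∷ ss)
    cert-bottom top    (_ ∷ _) = refl
    cert-bottom bottom (_ ∷ _) = refl

    rest : ∀ {m} (ss : Vec Side (suc m)) → suc m + i ≡ n →
      countBelow (seenAt? n (pileFrom (suc i) ss)) (suc m) ≡ cert bottom ss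
    rest {zero}  (s ∷ [])       eq = none (seenAt? n (pileFrom (suc i) (s ∷ []))) 0 ¬Seen-[]
    rest {suc m} ss@(_ ∷ _ ∷ _) eq = countBelow-cert bottom ss (trans (+-suc (suc m) i) eq)
  countBelow-cert {n} {m} {i} p (top ∷ ss) eq = begin
    countBelow P? (suc (suc m))
      ≡⟨ countBelow-∷ P? (suc m) ⟩
    length (filter P? (0 ∷ [])) + countBelow (P? ∘ suc) (suc m)
      ≡⟨ cong₂ _+_ (none P? 0 ¬Seen-[]) (rest ss eq) ⟩
    cert top ss
      ≡⟨ cert-top p ss ⟩
    cert p (top ∷ ss)
      ∎
    where
    open ≡-Reasoning
    P? = seenAt? n (pileFrom i (top ∷ ss))

    cert-top : ∀ {m} p (ss : Vec Side (suc m)) → cert top ss ≡ cert p (top ∷ ss)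
    cert-top top    (_ ∷ _) = refl
    cert-top bottom (_ ∷ _) = refl

    rest : ∀ {m} (ss : Vec Side (suc m)) → suc m + i ≡ n →
      countBelow (seenAt? n (i ∷ pileFrom (suc i) ss) ∘ suc) (suc m) ≡ cert top ss
    rest {zero}  (s ∷ [])       eq =
      one (seenAt? n (i ∷ pileFrom (suc i) (s ∷ [])) ∘ suc) 0 (seen-penultimate [] eq)
    rest {suc m} ss@(_ ∷ _ ∷ _) eq = trans
      (countBelow-cong (seenAt? n (i ∷ pileFrom (suc i) ss) ∘ suc) (seenAt? n (pileFrom (suc i) ss))
        (suc (suc m)) λ _ → seen-top ss eq (s≤s z≤n))
      (countBelow-cert top ss (trans (+-suc (suc m) i) eq))

  -- For a single card both sides compute. The classification by `Seen` covers at least two cards,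
  -- with 0 as the card shown before card 1.
  L≡luck : (ω : Ω (suc n)) → L ω ≡ luck top ω
  L≡luck (top    ∷ [])   = refl
  L≡luck (bottom ∷ [])   = refl
  L≡luck ω@(_ ∷ _ ∷ _) = trans
    (countBelow-cong (pureLuck? ω) (earlyHit? _ 0 (shuffle ω)) _ (pureLuck⇔ (s≤s (s≤s z≤n)) ω))
    (countBelow-luck ω (+-comm _ 1) (previous refl))

  C≡cert : (ω : Ω (suc n)) → C ω ≡ cert top ω
  C≡cert (top    ∷ [])   = refl
  C≡cert (bottom ∷ [])   = refl
  C≡cert ω@(_ ∷ _ ∷ _) = trans
    (countBelow-cong (certified? ω) (seenAt? _ (shuffle ω)) _ (certified⇔ (s≤s (s≤s z≤n)) ω))
    (countBelow-cert top ω (+-comm _ 1))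

open Game using (luck; cert; L≡luck; C≡cert)

-- Expectations over the sides and the two-state recurrence.

module Expectation {c ℓ} (R : CommutativeRing c ℓ) (h : CommutativeRing.Carrier R)
  (h+h≈1 : CommutativeRing._≈_ R (CommutativeRing._+_ R h h) (CommutativeRing.1# R)) where
  open CommutativeRing R
  open RawSemiringDefinitions (RawRing.rawSemiring rawRing) using (_^_)
  open CommutativeSemigroupProperties *-commutativeSemigroup using (x∙yz≈y∙xz)
  open SetoidReasoning setoid

  module _ {A : Set} where
    Σ : (A → Carrier) → List A → Carrier
    Σ f = foldr (λ x s → f x + s) 0#

    Σ-cong : ∀ {f g} → (∀ x → f x ≈ g x) → ∀ xs → Σ f xs ≈ Σ g xs
    Σ-cong f≈g []       = refl
    Σ-cong f≈g (x ∷ xs) = +-cong (f≈g x) (Σ-cong f≈g xs)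

    Σ-++ : ∀ f xs ys → Σ f (xs ++ ys) ≈ Σ f xs + Σ f ys
    Σ-++ f []       ys = sym (+-identityˡ (Σ f ys))
    Σ-++ f (x ∷ xs) ys = trans (+-congˡ (Σ-++ f xs ys)) (sym (+-assoc (f x) (Σ f xs) (Σ f ys)))

    Σ-scale : ∀ a f xs → Σ (λ x → a * f x) xs ≈ a * Σ f xs
    Σ-scale a f []       = sym (zeroʳ a)
    Σ-scale a f (x ∷ xs) = trans (+-congˡ (Σ-scale a f xs)) (sym (distribˡ a (f x) (Σ f xs)))

  Σ-map : ∀ {A B : Set} (f : B → Carrier) (φ : A → B) xs → Σ f (map φ xs) ≈ Σ (f ∘ φ) xs
  Σ-map f φ []       = refl
  Σ-map f φ (x ∷ xs) = +-congˡ (Σ-map f φ xs)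

  -- For `ℚ[v,w]` and the constant ½ this unfolds to `𝔼`.
  E : ∀ n → (Ω n → Carrier) → Carrier
  E n X = Σ (λ ω → h ^ n * X ω) (outcomes n)

  E-cong : ∀ n {X Y : Ω n → Carrier} → (∀ ω → X ω ≈ Y ω) → E n X ≈ E n Y
  E-cong n X≈Y = Σ-cong (λ ω → *-congˡ (X≈Y ω)) (outcomes n)

  E-scale : ∀ n a (X : Ω n → Carrier) → E n (λ ω → a * X ω) ≈ a * E n X
  E-scale n a X = trans (Σ-cong (λ ω → x∙yz≈y∙xz (h ^ n) a (X ω)) (outcomes n))
    (Σ-scale a (λ ω → h ^ n * X ω) (outcomes n))

  E-suc : ∀ n (X : Ω (suc n) → Carrier) → E (suc n) X ≈ h * (E n (X ∘ (top ∷_)) + E n (X ∘ (bottom ∷_)))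
  E-suc n X = begin
    Σ f (map (top ∷_) (outcomes n) ++ map (bottom ∷_) (outcomes n))
      ≈⟨ Σ-++ f (map (top ∷_) (outcomes n)) (map (bottom ∷_) (outcomes n)) ⟩
    Σ f (map (top ∷_) (outcomes n)) + Σ f (map (bottom ∷_) (outcomes n))
      ≈⟨ +-cong (half top) (half bottom) ⟩
    h * E n (X ∘ (top ∷_)) + h * E n (X ∘ (bottom ∷_))
      ≈⟨ distribˡ h (E n (X ∘ (top ∷_))) (E n (X ∘ (bottom ∷_))) ⟨
    h * (E n (X ∘ (top ∷_)) + E n (X ∘ (bottom ∷_)))
      ∎
    where
    f : Ω (suc n) → Carrier
    f ω = h ^ suc n * X ω

    half : ∀ s → Σ f (map (s ∷_) (outcomes n)) ≈ h * E n (X ∘ (s ∷_))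
    half s = begin
      Σ f (map (s ∷_) (outcomes n))                        ≈⟨ Σ-map f (s ∷_) (outcomes n) ⟩
      Σ (f ∘ (s ∷_)) (outcomes n)
        ≈⟨ Σ-cong (λ ω → *-assoc h (h ^ n) (X (s ∷ ω))) (outcomes n) ⟩
      Σ (λ ω → h * (h ^ n * X (s ∷ ω))) (outcomes n)
        ≈⟨ Σ-scale h (λ ω → h ^ n * X (s ∷ ω)) (outcomes n) ⟩
      h * E n (X ∘ (s ∷_))                                   ∎

  E-const₁ : ∀ (X : Ω 1 → Carrier) {a} → (∀ s → X (s ∷ []) ≈ a) → E 1 X ≈ a
  E-const₁ X {a} X≈a = begin
    h * 1# * X (top ∷ []) + (h * 1# * X (bottom ∷ []) + 0#)
      ≈⟨ +-cong (half top) (trans (+-identityʳ _) (half bottom)) ⟩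
    h * a + h * a  ≈⟨ distribʳ a h h ⟨
    (h + h) * a    ≈⟨ *-congʳ h+h≈1 ⟩
    1# * a         ≈⟨ *-identityˡ a ⟩
    a              ∎
    where
    half : ∀ s → h * 1# * X (s ∷ []) ≈ h * a
    half s = *-cong (*-identityʳ h) (X≈a s)

  module _ (x y : Carrier) where
    weight : ∀ {n} → Side → Ω (suc n) → Carrier
    weight p ω = x ^ luck p ω * y ^ cert p ω

    -- The coefficients of the series A (for `top`) and B (for `bottom`). Index n belongs to n + 1
    -- cards, whence the factor z in S = z A.
    G : Side → ℕ → Carrier
    G p n = E (suc n) (weight p)

    G-top-0 : G top 0 ≈ y
    G-top-0 = E-const₁ (weight top) λ _ → trans (*-identityˡ (y * 1#)) (*-identityʳ y)

    G-bottom-0 : G bottom 0 ≈ 1#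
    G-bottom-0 = E-const₁ (weight bottom) λ _ → *-identityˡ 1#

    private
      bottom-first : ∀ p {n} (ω : Ω (suc n)) → weight p (bottom ∷ ω) ≈ y * weight bottom ω
      bottom-first top    ω@(_ ∷ _) = x∙yz≈y∙xz (x ^ luck bottom ω) y (y ^ cert bottom ω)
      bottom-first bottom ω@(_ ∷ _) = x∙yz≈y∙xz (x ^ luck bottom ω) y (y ^ cert bottom ω)

      top-first-top : ∀ {n} (ω : Ω (suc n)) → weight top (top ∷ ω) ≈ x * weight top ω
      top-first-top ω@(_ ∷ _) = *-assoc x (x ^ luck top ω) (y ^ cert top ω)

      top-first-bottom : ∀ {n} (ω : Ω (suc n)) → weight bottom (top ∷ ω) ≈ weight top ω
      top-first-bottom (_ ∷ _) = refl

    G-top-suc : ∀ n → G top (suc n) ≈ h * (x * G top n + y * G bottom n)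
    G-top-suc n = trans (E-suc (suc n) (weight top)) (*-congˡ (+-cong
      (trans (E-cong (suc n) top-first-top) (E-scale (suc n) x (weight top)))
      (trans (E-cong (suc n) (bottom-first top)) (E-scale (suc n) y (weight bottom)))))

    G-bottom-suc : ∀ n → G bottom (suc n) ≈ h * (G top n + y * G bottom n)
    G-bottom-suc n = trans (E-suc (suc n) (weight bottom)) (*-congˡ (+-cong
      (E-cong (suc n) top-first-bottom)
      (trans (E-cong (suc n) (bottom-first bottom)) (E-scale (suc n) y (weight bottom)))))

    module _ (z : ℕ → Carrier)
      (z₀≈0 : z 0 ≈ 0#) (z₊≈1 : ∀ k → z (suc k) ≈ constSeries rawRing 1# k) where
      open PowerSeries R hiding (commutativeRing)
      private
        module P = CommutativeRing (PowerSeries.commutativeRing R)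
        open P using () renaming (_+_ to _⊕_; _*_ to _⊛_)

        ⌊_⌋ : Carrier → ℕ → Carrier
        ⌊_⌋ = constSeries rawRing

        A B : ℕ → Carrier
        A = G top
        B = G bottom

      shift-zero : ∀ f → (z ⊛ f) 0 ≈ 0#
      shift-zero f = trans (*-congʳ z₀≈0) (zeroˡ (f 0))

      shift-suc : ∀ f n → (z ⊛ f) (suc n) ≈ f n
      shift-suc f n = begin
        z 0 * f (suc n) + (z ∘ suc ⊛ f) n
          ≈⟨ +-cong (trans (*-congʳ z₀≈0) (zeroˡ (f (suc n)))) (⊛-cong z₊≈1 (λ _ → refl) n) ⟩
        0# + (P.1# ⊛ f) n
          ≈⟨ +-identityˡ ((P.1# ⊛ f) n) ⟩
        (P.1# ⊛ f) n
          ≈⟨ ⊛-identityˡ f n ⟩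
        f n
          ∎

      private
        halved : ∀ f n → (⌊ h ⌋ ⊛ z ⊛ f) n ≈ h * (z ⊛ f) n
        halved f n = trans (⊛-assoc ⌊ h ⌋ z f n) (⊛-constˡ h (z ⊛ f) n)

        -- Multiplication by z/2 shifts and halves, so an initial value and a coefficient recurrence
        -- amount to one equation of series. `g` gives the coefficients of `f` with constants acting
        -- by plain multiplication.
        recurrence : ∀ {F} (f g : ℕ → Carrier) {a} → F 0 ≈ a → (∀ n → F (suc n) ≈ h * g n) → (∀ n → f n ≈ g n) →
          F P.≈ ⌊ a ⌋ ⊕ ⌊ h ⌋ ⊛ z ⊛ f
        recurrence {F} f g {a} F₀ F₊ f≈g zero = begin
          F 0                        ≈⟨ F₀ ⟩
          a                          ≈⟨ +-identityʳ a ⟨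
          a + 0#                     ≈⟨ +-congˡ (trans (halved f 0) (trans (*-congˡ (shift-zero f)) (zeroʳ h))) ⟨
          a + (⌊ h ⌋ ⊛ z ⊛ f) 0      ∎
        recurrence {F} f g {a} F₀ F₊ f≈g (suc n) = begin
          F (suc n)                        ≈⟨ F₊ n ⟩
          h * g n                          ≈⟨ *-congˡ (f≈g n) ⟨
          h * f n                          ≈⟨ *-congˡ (shift-suc f n) ⟨
          h * (z ⊛ f) (suc n)              ≈⟨ halved f (suc n) ⟨
          (⌊ h ⌋ ⊛ z ⊛ f) (suc n)          ≈⟨ +-identityˡ _ ⟨
          0# + (⌊ h ⌋ ⊛ z ⊛ f) (suc n)     ∎

      G-top-series : A P.≈ ⌊ y ⌋ ⊕ ⌊ h ⌋ ⊛ z ⊛ (⌊ x ⌋ ⊛ A ⊕ ⌊ y ⌋ ⊛ B)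
      G-top-series = recurrence (⌊ x ⌋ ⊛ A ⊕ ⌊ y ⌋ ⊛ B) (λ n → x * A n + y * B n)
        G-top-0 G-top-suc λ n → +-cong (⊛-constˡ x A n) (⊛-constˡ y B n)

      G-bottom-series : B P.≈ P.1# ⊕ ⌊ h ⌋ ⊛ z ⊛ (A ⊕ ⌊ y ⌋ ⊛ B)
      G-bottom-series = recurrence (A ⊕ ⌊ y ⌋ ⊛ B) (λ n → A n + y * B n)
        G-bottom-0 G-bottom-suc λ n → +-congˡ (⊛-constˡ y B n)

-- The generating function S and its two closed forms.

open import Defs

module Q = CommutativeRing ℚ[v,w]-commutativeRing
module K = CommutativeRing ℚ[v,w]⟦z⟧-commutativeRing
module PS = PowerSeries ℚ[v,w]-commutativeRing

½+½≈1 : ℚ[v,w].const ½ Q.+ ℚ[v,w].const ½ Q.≈ Q.1#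
½+½≈1 zero    zero    = ≡.refl
½+½≈1 zero    (suc _) = ≡.refl
½+½≈1 (suc _) _       = ≡.refl

open Expectation ℚ[v,w]-commutativeRing (ℚ[v,w].const ½) ½+½≈1

z₊≈1 : ∀ k → z (suc k) Q.≈ 1# k
z₊≈1 zero    = Q.refl {Q.1#}
z₊≈1 (suc k) = Q.refl {Q.0#}

A B : Series
A = G ℚ[v,w].v ℚ[v,w].w top
B = G ℚ[v,w].v ℚ[v,w].w bottom

A≈ : A ≈ w + ½ₛ * z * (v * A + w * B)
A≈ = G-top-series ℚ[v,w].v ℚ[v,w].w z (Q.refl {Q.0#}) z₊≈1

B≈ : B ≈ 1# + ½ₛ * z * (A + w * B)
B≈ = G-bottom-series ℚ[v,w].v ℚ[v,w].w z (Q.refl {Q.0#}) z₊≈1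

-- For n ≥ 1 the statistics L and C are replaced by `luck` and `cert`, started at `top` because card
-- 0 counts as on top.
S≈z*A : S ≈ z * A
S≈z*A zero    = Q.sym {(z * A) 0} {Q.0#} (shift-zero ℚ[v,w].v ℚ[v,w].w z (Q.refl {Q.0#}) z₊≈1 A)
S≈z*A (suc n) = Q.trans {S (suc n)} {A n} {(z * A) (suc n)}
  (E-cong (suc n) {X} {weight ℚ[v,w].v ℚ[v,w].w top} λ ω → Q.reflexive {X ω}
    (≡.cong₂ (λ l c → ℚ[v,w].v ℚ[v,w].^ l Q.* ℚ[v,w].w ℚ[v,w].^ c) (L≡luck ω) (C≡cert ω)))
  (Q.sym {(z * A) (suc n)} {A n} (shift-suc ℚ[v,w].v ℚ[v,w].w z (Q.refl {Q.0#}) z₊≈1 A n))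
  where
  X : Ω (suc n) → ℚ[v,w].Carrier
  X ω = ℚ[v,w].v ℚ[v,w].^ L ω Q.* ℚ[v,w].w ℚ[v,w].^ C ω

open ℚ-Algebra ℚ[v,w]⟦z⟧-commutativeRing ⌜_⌝ ⌜⌝-isRingHomomorphism
  using (solution; fractions-≈; x/y-unique)

lemma10 : ( S ≈
    (z * w + (½ₛ * z ^ 2 * w) ÷ (1# - ½ₛ * z * w) [ unit₁ ])
    ÷ (1# - ½ₛ * z * v - (½ₛ * z) ÷ (1# - ½ₛ * z * w) [ unit₁ ] + ½ₛ * z) [ unit₂ ] )
    ×
    ( (z * w + (½ₛ * z ^ 2 * w) ÷ (1# - ½ₛ * z * w) [ unit₁ ])
    ÷ (1# - ½ₛ * z * v - (½ₛ * z) ÷ (1# - ½ₛ * z * w) [ unit₁ ] + ½ₛ * z) [ unit₂ ]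
    ≈
    (2ₛ * z * w * (2ₛ + (1# - w) * z))
    ÷ (4ₛ + w * (v - 1#) * z ^ 2 - 2ₛ * z * (v + w)) [ unit₃ ] )
lemma10 =
  -- It suffices that S times the denominator is the numerator, since the denominator is invertible.
  x/y-unique {S} {D₁} {inverse ℚ[v,w] D₁ unit₂} {N₁} (PS.⊛-inverseʳ D₁ unit₂)
    (K.trans {S * D₁} {z * A * D₁} {N₁} (K.*-congʳ {D₁} {S} {z * A} S≈z*A)
      (solution z v w i qi≈1 {A} {B} A≈ B≈)) ,
  fractions-≈ z v w i qi≈1 (PS.⊛-inverseʳ D₁ unit₂) (PS.⊛-inverseʳ D₂ unit₃)
  where
  q i N₁ D₁ D₂ : Series
  q  = 1# - ½ₛ * z * w
  i  = inverse ℚ[v,w] q unit₁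
  N₁ = z * w + (½ₛ * z ^ 2 * w) * i
  D₁ = 1# - ½ₛ * z * v - (½ₛ * z) * i + ½ₛ * z
  D₂ = 4ₛ + w * (v - 1#) * z ^ 2 - 2ₛ * z * (v + w)

  qi≈1 : q * i ≈ 1#
  qi≈1 = PS.⊛-inverseʳ q unit₁
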